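{- For a subset $\widehat{\Lambda}\subseteq\Lambda$ let $$\mathrm{GF}_{\widehat{\Lambda}}(y_1,y_2,y_3)=\mathrm{GF}_{\widehat{\Lambda}}(y_1,y_2,y_3;q):=\sum_{\lambda\in\widehat{\Lambda}} y_1^{\mathrm{len}_R(\lambda)}\,y_2^{\mathrm{len}_G(\lambda)}\,y_3^{\mathrm{len}_B(\lambda)}\,q^{|\lambda|},$$ and let $$T(y_1,y_2,y_3)=T(y_1,y_2,y_3;q):=\sum_{n_1,n_2,n_3\ge 0} q^{3\binom{n_1}{2}+\binom{n_2}{2}+\binom{n_3}{2}+n_1n_2+n_2n_3+n_3n_1}\,\frac{y_1^{n_1}y_2^{n_2}y_3^{n_3}\,(-q;q)_{n_1+n_2+n_3}}{(q^2;q^2)_{n_1}(q^2;q^2)_{n_2}(q^2;q^2)_{n_3}}.$$ Then $$\mathrm{GF}_{\Lambda}(y_1,y_2,y_3)=T(y_1q,\,y_2q,\,y_3q^2)+y_3q\,T(y_1q^3,\,y_2q^3,\,y_3q^2),$$ $$\mathrm{GF}_{\Lambda_{\{1_R\}}}(y_1,y_2,y_3)=T(y_1q^2,\,y_2q^2,\,y_3q)+y_2q\,T(y_1q^4,\,y_2q^2,\,y_3q^3),$$ $$\mathrm{GF}_{\Lambda_{\{1_R,2_R,1_B\}}}(y_1,y_2,y_3)=T(y_1q^3,\,y_2q,\,y_3q^2),$$ $$\mathrm{GF}_{\Lambda_{\{1_R,1_G\}}}(y_1,y_2,y_3)=T(y_1q^2,\,y_2q^2,\,y_3q).$$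
   Context: A three-colored partition is a finite (possibly empty) partition into positive integer parts in which each part is assigned one of three colors: red, green, blue, indicated by subscripts $R,G,B$ (so $j_R$ is a red part of size $j$, etc.). For a three-colored partition $\lambda$, $|\lambda|$ is the sum of its parts, and $\mathrm{len}_R(\lambda),\mathrm{len}_G(\lambda),\mathrm{len}_B(\lambda)$ are the numbers of red, green and blue parts, respectively. $\Lambda$ is the set of three-colored partitions (including the empty one) such that: (i) each part size, counting all three colors together, appears at most once; (ii) for every $j\ge 1$, none of the following pairs of parts both occur: $j_R$ and $(j+1)_R$; $j_R$ and $(j+2)_R$; $j_R$ and $(j+1)_B$; $j_G$ and $(j+1)_R$; $j_G$ and $(j+2)_R$; $j_G$ and $(j+1)_B$; $j_B$ and $(j+1)_R$; $j_B$ and $(j+1)_G$. For a collection $S$ of colored parts, $\Lambda_S$ is the subset of $\Lambda$ consisting of the partitions having no parts from $S$. The $q$-Pochhammer symbol is $(A;q)_n:=\prod_{k=0}^{n-1}(1-Aq^k)$ for $n\in\mathbb{N}\cup\{\infty\}$. Identities are between formal power series in $y_1,y_2,y_3,q$. -}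

module Defs where

open import Algebra.Bundles using (RawRing)
import Algebra.Definitions.RawSemiring as RawSemiringDefs
open import Data.Empty using (⊥)
open import Data.Fin.Base using (toℕ)
open import Data.Integer.Base using (+-*-rawRing)
open import Data.List.Base
  using (List; []; _∷_; _++_; [_]; map; filter; foldr; length; concatMap)
open import Data.List.Membership.Propositional using (_∈_; _∉_; find; lose)
open import Data.List.Membership.Propositional.Properties
  using (∈-++⁺ˡ; ∈-++⁺ʳ; ∈-++⁻; ∈-map⁺; ∈-map⁻; ∈-filter⁺; ∈-filter⁻;
         ∈-concatMap⁺; ∈-concatMap⁻)
open import Data.List.Relation.Unary.All using (All; []; _∷_; all?)
open import Data.List.Relation.Unary.AllPairs using ([]; _∷_)
open import Data.List.Relation.Unary.Any using (here; there)
open import Data.List.Relation.Unary.Linked using (Linked; linked?)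
open import Data.List.Relation.Unary.Unique.Propositional using (Unique)
import Data.List.Relation.Unary.Unique.Propositional.Properties as Unique
import Data.List.Relation.Unary.Unique.DecPropositional as DecUnique
import Data.List.Membership.DecPropositional as DecMembership
open import Data.Nat.Base as ℕ using (ℕ; zero; suc; _<_; _≤_; z≤n; s≤s)
open import Data.Nat.ListAction using () renaming (sum to sumℕ)
open import Data.Nat.Combinatorics using () renaming (_C_ to _choose_)
import Data.Nat.Properties as ℕ
open import Data.Product.Base using (_×_; _,_; proj₁; proj₂)
open import Data.Product.Properties using (≡-dec)
open import Data.Sum.Base using (_⊎_; inj₁; inj₂)
open import Level using (0ℓ)
open import Relation.Binary.Definitions using (DecidableEquality)
open import Relation.Binary.PropositionalEquality
  using (_≡_; refl; sym; trans; subst)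
open import Relation.Nullary.Decidable using (Dec; yes; no; _×-dec_; _⊎-dec_; ¬?)
open import Relation.Unary using (Pred; Decidable)

------------------------------------------------------------------------
-- Three-colored partitions

data Color : Set where
  R G B : Color

_≟ᶜ_ : DecidableEquality Color
R ≟ᶜ R = yes refl
R ≟ᶜ G = no λ ()
R ≟ᶜ B = no λ ()
G ≟ᶜ R = no λ ()
G ≟ᶜ G = yes refl
G ≟ᶜ B = no λ ()
B ≟ᶜ R = no λ ()
B ≟ᶜ G = no λ ()
B ≟ᶜ B = yes refl

-- (j , R) is the red part of size j, and so on.
Part : Set
Part = ℕ × Color

size : Part → ℕ
size = proj₁

color : Part → Color
color = proj₂

_≟ᵖ_ : DecidableEquality Part
_≟ᵖ_ = ≡-dec ℕ._≟_ _≟ᶜ_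

rank : Color → ℕ
rank R = 0
rank G = 1
rank B = 2

infix 4 _≼_ _≼?_

_≼_ : Part → Part → Set
(i , c) ≼ (j , d) = i < j ⊎ (i ≡ j × rank c ≤ rank d)

_≼?_ : ∀ p p′ → Dec (p ≼ p′)
(i , c) ≼? (j , d) = (i ℕ.<? j) ⊎-dec ((i ℕ.≟ j) ×-dec (rank c ℕ.≤? rank d))

-- A partition is a finite multiset of parts.  Each multiset is represented by
-- the unique list of its elements that is weakly increasing for the total
-- order _≼_; the way _≼_ breaks ties between parts of equal size is arbitrary.
IsPartition : Pred (List Part) 0ℓ
IsPartition π = All (λ p → 1 ≤ size p) π × Linked _≼_ π

isPartition? : Decidable IsPartition
isPartition? π = all? (λ p → 1 ℕ.≤? size p) π ×-dec linked? _≼?_ π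

∣_∣ₚ : List Part → ℕ
∣ π ∣ₚ = sumℕ (map size π)

len : Color → List Part → ℕ
len c π = length (filter (λ p → color p ≟ᶜ c) π)

-- The parts of larger size that must not occur together with a given part.
excludedBy : Part → List Part
excludedBy (j , R) = (j ℕ.+ 1 , R) ∷ (j ℕ.+ 2 , R) ∷ (j ℕ.+ 1 , B) ∷ []
excludedBy (j , G) = (j ℕ.+ 1 , R) ∷ (j ℕ.+ 2 , R) ∷ (j ℕ.+ 1 , B) ∷ []
excludedBy (j , B) = (j ℕ.+ 1 , R) ∷ (j ℕ.+ 1 , G) ∷ []

open DecMembership _≟ᵖ_ using (_∈?_)

Λ : Pred (List Part) 0ℓ
Λ π = IsPartition π
    × Unique (map size π)
    × All (λ p → All (_∉ π) (excludedBy p)) π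

Λ? : Decidable Λ
Λ? π = isPartition? π
  ×-dec DecUnique.unique? ℕ._≟_ (map size π)
  ×-dec all? (λ p → all? (λ p′ → ¬? (p′ ∈? π)) (excludedBy p)) π

Λ[_] : List Part → Pred (List Part) 0ℓ
Λ[ S ] π = Λ π × All (_∉ S) π

Λ[_]? : ∀ S → Decidable Λ[ S ]
Λ[ S ]? π = Λ? π ×-dec all? (λ p → ¬? (p ∈? S)) π

------------------------------------------------------------------------
-- Enumeration of the partitions of n

-- A nonempty colored composition arises in exactly one way from one of total
-- size smaller by 1: by prepending a part of size 1 or by increasing its
-- first part by 1.
grow : List Part → List (List Part)
grow []            = []
grow ((j , c) ∷ π) = [ (suc j , c) ∷ π ]

prependOne : List Part → List (List Part)
prependOne π = map (λ c → (1 , c) ∷ π) (R ∷ G ∷ B ∷ [])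

compositions : ℕ → List (List Part)
compositions zero    = [ [] ]
compositions (suc n) = concatMap (λ π → prependOne π ++ grow π) (compositions n)

partitions : ℕ → List (List Part)
partitions n = filter isPartition? (compositions n)

private

  colors : ∀ c → c ∈ R ∷ G ∷ B ∷ []
  colors R = here refl
  colors G = there (here refl)
  colors B = there (there (here refl))

  Positive : Pred (List Part) 0ℓ
  Positive = All (λ p → 1 ≤ size p)

  extend : List Part → List (List Part)
  extend π = prependOne π ++ grow π

  compositions-complete : ∀ n π → Positive π → ∣ π ∣ₚ ≡ n → π ∈ compositions n
  compositions-complete zero    []                      _        _  = here refl
  compositions-complete (suc n) []                      _        ()
  compositions-complete n       ((zero , c) ∷ π)        (() ∷ _) _
  compositions-complete zero    ((suc j , c) ∷ π)       _        ()
  compositions-complete (suc n) ((suc zero , c) ∷ π)    (_ ∷ ps) eq =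
    ∈-concatMap⁺ extend (lose
      (compositions-complete n π ps (ℕ.suc-injective eq))
      (∈-++⁺ˡ (∈-map⁺ (λ d → (1 , d) ∷ π) (colors c))))
  compositions-complete (suc n) ((suc (suc j) , c) ∷ π) (_ ∷ ps) eq =
    ∈-concatMap⁺ extend (lose
      (compositions-complete n ((suc j , c) ∷ π) (s≤s z≤n ∷ ps) (ℕ.suc-injective eq))
      (∈-++⁺ʳ (prependOne ((suc j , c) ∷ π)) (here refl)))

  shrink : List Part → List Part
  shrink []                      = []
  shrink ((suc (suc j) , c) ∷ π) = (suc j , c) ∷ π
  shrink ((_ , _) ∷ π)           = π

  extend-spec : ∀ x {y} → Positive x → y ∈ extend x →
                Positive y × ∣ y ∣ₚ ≡ suc ∣ x ∣ₚ × shrink y ≡ x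
  extend-spec x ps y∈ with ∈-++⁻ (prependOne x) y∈
  ... | inj₁ i with ∈-map⁻ (λ d → (1 , d) ∷ x) i
  ...   | _ , _ , refl = (s≤s z≤n ∷ ps) , refl , refl
  extend-spec ((suc j , c) ∷ x) (_ ∷ ps) y∈ | inj₂ (here refl) =
    (s≤s z≤n ∷ ps) , refl , refl

  compositions-sound : ∀ n {π} → π ∈ compositions n → Positive π × ∣ π ∣ₚ ≡ n
  compositions-sound zero    (here refl) = [] , refl
  compositions-sound (suc n) π∈ with find (∈-concatMap⁻ extend {xs = compositions n} π∈)
  ... | x , x∈ , i with compositions-sound n x∈
  ...   | ps , refl with extend-spec x ps i
  ...     | ps′ , eq , _ = ps′ , eq

  extend-unique : ∀ x → Positive x → Unique (extend x)
  extend-unique []                _ = ((λ ()) ∷ (λ ()) ∷ []) ∷ ((λ ()) ∷ []) ∷ [] ∷ []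
  extend-unique ((suc j , c) ∷ x) _ =
      ((λ ()) ∷ (λ ()) ∷ (λ ()) ∷ [])
    ∷ ((λ ()) ∷ (λ ()) ∷ [])
    ∷ ((λ ()) ∷ [])
    ∷ [] ∷ []
  extend-unique ((zero , c) ∷ x) (() ∷ _)

  concat-unique : ∀ xs → (∀ {x} → x ∈ xs → Positive x) → Unique xs →
                  Unique (concatMap extend xs)
  concat-unique []       _   _        = []
  concat-unique (x ∷ xs) pos (x∉ ∷ u) = Unique.++⁺
    (extend-unique x (pos (here refl)))
    (concat-unique xs (λ i → pos (there i)) u)
    disjoint
    where
    absent : ∀ {ys} → All (λ y → x ≡ y → ⊥) ys → x ∈ ys → ⊥
    absent (n ∷ _)  (here eq) = n eq
    absent (_ ∷ ns) (there i) = absent ns i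

    disjoint : ∀ {v} → v ∈ extend x × v ∈ concatMap extend xs → ⊥
    disjoint (i , j) with find (∈-concatMap⁻ extend {xs = xs} j)
    ... | z , z∈ , k = absent x∉ (subst (_∈ xs) z≡x z∈)
      where
      z≡x : z ≡ x
      z≡x = trans (sym (proj₂ (proj₂ (extend-spec z (pos (there z∈)) k))))
                  (proj₂ (proj₂ (extend-spec x (pos (here refl)) i)))

  compositions-unique : ∀ n → Unique (compositions n)
  compositions-unique zero    = [] ∷ []
  compositions-unique (suc n) = concat-unique (compositions n)
    (λ i → proj₁ (compositions-sound n i)) (compositions-unique n)

-- partitions n lists every three-colored partition of n exactly once.

partitions-complete : ∀ {n π} → IsPartition π → ∣ π ∣ₚ ≡ n → π ∈ partitions n
partitions-complete {n} {π} isP eq =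
  ∈-filter⁺ isPartition? (compositions-complete n π (proj₁ isP) eq) isP

partitions-sound : ∀ {n π} → π ∈ partitions n → IsPartition π × ∣ π ∣ₚ ≡ n
partitions-sound {n} π∈ with ∈-filter⁻ isPartition? {xs = compositions n} π∈
... | i , isP = isP , proj₂ (compositions-sound n i)

partitions-unique : ∀ n → Unique (partitions n)
partitions-unique n = Unique.filter⁺ isPartition? (compositions-unique n)

------------------------------------------------------------------------
-- Formal power series

module Series {c ℓ} (𝓡 : RawRing c ℓ) where

  open RawRing 𝓡
  open RawSemiringDefs rawSemiring using (sum)

  -- f n is the coefficient of the n-th power of the variable.
  rawRing⟦X⟧ : RawRing c ℓ
  rawRing⟦X⟧ = record
    { Carrier = ℕ → Carrier
    ; _≈_     = λ f g → ∀ n → f n ≈ g n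
    ; _+_     = λ f g n → f n + g n
    ; _*_     = λ f g n → sum {suc n} (λ i → f (toℕ i) * g (n ℕ.∸ toℕ i))
    ; -_      = λ f n → - f n
    ; 0#      = λ _ → 0#
    ; 1#      = λ { zero → 1# ; (suc _) → 0# }
    }

  const : Carrier → ℕ → Carrier
  const r zero    = r
  const r (suc _) = 0#

  X : ℕ → Carrier
  X (suc zero) = 1#
  X _          = 0#

-- ℤ⟦q⟧⟦y₃⟧⟦y₂⟧⟦y₁⟧, with carrier ℕ → ℕ → ℕ → ℕ → ℤ: the coefficient of
-- y₁ᵃ y₂ᵇ y₃ᶜ qᵈ in f is f a b c d.

module Sq = Series +-*-rawRing
module S₃ = Series Sq.rawRing⟦X⟧
module S₂ = Series S₃.rawRing⟦X⟧
module S₁ = Series S₂.rawRing⟦X⟧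

open RawRing S₁.rawRing⟦X⟧ public
  using (_≈_; _+_; _*_; -_; 0#; 1#; rawSemiring)
  renaming (Carrier to PowerSeries)
open RawSemiringDefs rawSemiring public using (_^_; sum)

infixl 6 _-_
infixl 7 _/_
infix  8 _⁻¹

y₁ y₂ y₃ q : PowerSeries
y₁ = S₁.X
y₂ = S₁.const S₂.X
y₃ = S₁.const (S₂.const S₃.X)
q  = S₁.const (S₂.const (S₃.const Sq.X))

_-_ : PowerSeries → PowerSeries → PowerSeries
f - g = f + (- g)

-- The infinite sum of F k over k ≥ 0, for families in which every monomial of
-- F k has total degree at least k: the terms with k > a + b + c + d then do
-- not contribute to the coefficient of y₁ᵃ y₂ᵇ y₃ᶜ qᵈ.  All uses below are of
-- this kind.
∑∞ : (ℕ → PowerSeries) → PowerSeries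
∑∞ F a b c d = sum {suc (a ℕ.+ b ℕ.+ c ℕ.+ d)} (λ k → F (toℕ k)) a b c d

-- The multiplicative inverse of a series with constant term 1, as the
-- geometric series in 1 - f.
_⁻¹ : PowerSeries → PowerSeries
f ⁻¹ = ∑∞ λ k → (1# - f) ^ k

_/_ : PowerSeries → PowerSeries → PowerSeries
f / g = f * g ⁻¹

-- The q-Pochhammer symbol (A ; Q)ₙ for finite n.
⟨_⨾_⟩_ : PowerSeries → PowerSeries → ℕ → PowerSeries
⟨ A ⨾ Q ⟩ zero    = 1#
⟨ A ⨾ Q ⟩ (suc n) = ⟨ A ⨾ Q ⟩ n * (1# - A * Q ^ n)

------------------------------------------------------------------------
-- The two sides of the identities

weight : List Part → PowerSeries
weight π = y₁ ^ len R π * y₂ ^ len G π * y₃ ^ len B π * q ^ ∣ π ∣ₚ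

-- The sum of the weights of all three-colored partitions satisfying P, grouped
-- by the partitioned number n.
GF : {P : Pred (List Part) 0ℓ} → Decidable P → PowerSeries
GF P? = ∑∞ λ n → foldr _+_ 0# (map weight (filter P? (partitions n)))

exponent : ℕ → ℕ → ℕ → ℕ
exponent n₁ n₂ n₃ =
  3 ℕ.* (n₁ choose 2) ℕ.+ (n₂ choose 2) ℕ.+ (n₃ choose 2)
    ℕ.+ n₁ ℕ.* n₂ ℕ.+ n₂ ℕ.* n₃ ℕ.+ n₃ ℕ.* n₁

-- The arguments Y₁, Y₂, Y₃ must have constant term 0.
T : PowerSeries → PowerSeries → PowerSeries → PowerSeries
T Y₁ Y₂ Y₃ = ∑∞ λ n₁ → ∑∞ λ n₂ → ∑∞ λ n₃ →
  q ^ exponent n₁ n₂ n₃ *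
  ( (Y₁ ^ n₁ * Y₂ ^ n₂ * Y₃ ^ n₃ * ⟨ - q ⨾ q ⟩ (n₁ ℕ.+ n₂ ℕ.+ n₃))
  / (⟨ q ^ 2 ⨾ q ^ 2 ⟩ n₁ * ⟨ q ^ 2 ⨾ q ^ 2 ⟩ n₂ * ⟨ q ^ 2 ⨾ q ^ 2 ⟩ n₃) )

{-# OPTIONS --safe #-}

-- Reading a partition in Λ from its smallest part upwards, only four states occur:
-- no restriction, no (m + 1)_R, the restrictions left by m_R or m_G, and those left by
-- m_B; for m = 0 their generating functions are the four in the theorem.  Splitting
-- off the parts of size m + 1 gives a linear system of q-difference equations, which
-- determines the four series.
--
-- The right-hand sides satisfy the same system.  Let t be the coefficient of
-- y₁ᵃy₂ᵇy₃ᶜ in T(y₁, y₂, y₃).  With A = qᵃ, B = qᵇ, C = qᶜ, the quotient of consecutive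
-- coefficients gives
--   (1 − A²) t = (1 + ABC) P₁,  (1 − B²) t = (1 + ABC) P₂,  (1 − C²) t = (1 + ABC) P₃,
-- where P₁, P₂, P₃ are t(a − 1, b, c), t(a, b − 1, c), t(a, b, c − 1) times a power of q.
-- Three of the equations are linear consequences of these relations; the remaining
-- one, C t + AB P₃ = AB t + A²C P₂ + C P₁, follows after multiplication by 1 + ABC.
module Submission where

import Algebra.Definitions.RawSemiring as RawSemiringDefs
import Algebra.Properties.CommutativeSemigroup as CommutativeSemigroupProps
import Algebra.Properties.CommutativeSemiring.Exp as Exp
import Algebra.Properties.Ring as RingProps
import Algebra.Solver.Ring.NaturalCoefficients.Default as Solver
open import Algebra.Bundles using (CommutativeRing; RawRing)
open import Algebra.Structures using (IsCommutativeRing)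
open import Data.Empty using (⊥)
open import Data.Fin.Base using (toℕ)
open import Data.Integer.Base as ℤ using (ℤ; 0ℤ; 1ℤ)
import Data.Integer.Properties as ℤ
open import Data.List.Base using (List; []; _∷_; _++_; map; concatMap; foldr; filter)
open import Data.List.Membership.Propositional using (_∈_; _∉_; find; lose)
open import Data.List.Membership.Propositional.Properties
  using (∈-++⁺ˡ; ∈-++⁺ʳ; ∈-++⁻; ∈-map⁺; ∈-map⁻; ∈-concatMap⁺; ∈-concatMap⁻; ∈-filter⁺; ∈-filter⁻)
open import Data.List.Membership.Propositional.Properties.WithK using (unique∧set⇒bag)
open import Data.List.Properties using (filter-accept; filter-reject)
open import Data.List.Relation.Binary.BagAndSetEquality using (∼bag⇒↭)
open import Data.List.Relation.Binary.Permutation.Propositional as Perm using (_↭_)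
open import Data.List.Relation.Unary.All as All using (All; []; _∷_)
open import Data.List.Relation.Unary.All.Properties using (map⁺; map⁻)
open import Data.List.Relation.Unary.AllPairs using ([]; _∷_)
open import Data.List.Relation.Unary.Any using (here; there)
open import Data.List.Relation.Unary.Linked using (Linked; []; [-]; _∷_)
open import Data.List.Relation.Unary.Unique.Propositional using (Unique)
import Data.List.Relation.Unary.Unique.Propositional.Properties as Unique
open import Data.Nat.Base as ℕ using (ℕ; zero; suc; _≤_; _<_; z≤n; s≤s)
open import Data.Nat.Combinatorics using (nC1≡n; nCk+nC[k+1]≡[n+1]C[k+1]) renaming (_C_ to _choose_)
import Data.Nat.Properties as ℕ
open import Data.Nat.Solver using (module +-*-Solver)
open import Data.Product.Base using (∃; _×_; _,_; proj₁; proj₂)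
open import Data.Sum.Base using (inj₁; inj₂)
open import Function.Base using (_∘_)
open import Function.Bundles using (mk⇔)
open import Level using (0ℓ)
open import Relation.Binary.PropositionalEquality as ≡ using (_≡_; _≢_)
import Relation.Binary.Reasoning.Setoid as SetoidReasoning
open import Relation.Nullary.Decidable using (Dec; yes; no)
open import Relation.Nullary.Negation using (contradiction)
open import Relation.Unary using (Pred; Decidable)

-- Identities in commutative rings

-- The system determines the four series only together with an initial condition. Replacing every yᵢ
-- by yᵢqᵐ raises each part by m and multiplies the coefficient of y₁ᵃy₂ᵇy₃ᶜ by (ABC)ᵐ. The series
-- `𝕊 s m` is obtained in this way from a right-hand side, and it is therefore 1 modulo qᵐ.
-- Unrolling the system k times then compares it, modulo qᵐ⁺ᵏ, with a finite list of partitions into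
-- parts of sizes m + 1 to m + k.
--
-- Four states suffice although m_R and m_G reach as far as (m + 2)_R. If size m + 1 is skipped,
-- only (m + 2)_R remains excluded. Otherwise the next part is (m + 1)_G, which excludes (m + 2)_R
-- by itself.
--
-- The factor 1 + ABC is cancelled by inverting it, which needs constant term 1 and hence a + b + c
-- > 0. At the origin the constant term is 2, and the equation is checked there directly.
--
-- Relations are kept free of subtraction so that polynomial consequences can be left to a solver
-- for commutative semirings.

IsCommutative : RawRing 0ℓ 0ℓ → Set
IsCommutative 𝓡 = IsCommutativeRing _≈_ _+_ _*_ -_ 0# 1#
  where open RawRing 𝓡

bundle : ∀ {𝓡} → IsCommutative 𝓡 → CommutativeRing 0ℓ 0ℓ
bundle isCommutative = record { isCommutativeRing = isCommutative }

module RingIdentities (𝓡 : RawRing 0ℓ 0ℓ) (isCommutative : IsCommutative 𝓡) where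

  open CommutativeRing (bundle {𝓡} isCommutative)
  open RawSemiringDefs (RawRing.rawSemiring 𝓡) using (_^_; sum)
  open SetoidReasoning setoid
  open Solver commutativeSemiring using (solve; _:=_; _:+_; _:*_; con)
  open Exp commutativeSemiring public using (^-distrib-*; ^-homo-*; ^-congˡ)

  [x-y]+y≈x : ∀ x y → (x - y) + y ≈ x
  [x-y]+y≈x x y = trans (+-assoc _ _ _) (trans (+-congˡ (-‿inverseˡ y)) (+-identityʳ x))

  1--xy≈1+xy : ∀ x y → 1# - (- x) * y ≈ 1# + x * y
  1--xy≈1+xy x y = +-congˡ (trans (-‿cong (sym (RingProps.-‿distribˡ-* ring x y)))
                                  (RingProps.-‿involutive ring (x * y)))

  -- The remainder `x ^ n` is kept, so the identity is exact in every commutative ring and involves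
  -- no limit. For power series the remainder is removed later by its degree.
  geometric : ∀ x n → (1# - x) * sum {n} (λ i → x ^ toℕ i) + x ^ n ≈ 1#
  geometric x zero    = trans (+-congʳ (zeroʳ _)) (+-identityˡ _)
  geometric x (suc n) = begin
    (1# - x) * (1# + sum {n} (λ i → x ^ suc (toℕ i))) + x * x ^ n
      ≈⟨ +-congʳ (*-congˡ (+-congˡ (factor n (λ i → x ^ i)))) ⟩
    (1# - x) * (1# + x * s) + x * x ^ n
      ≈⟨ solve 4 (λ d x s p → d :* (con 1 :+ x :* s) :+ x :* p := d :+ x :* (d :* s :+ p))
           refl (1# - x) x s (x ^ n) ⟩
    (1# - x) + x * ((1# - x) * s + x ^ n)
      ≈⟨ +-congˡ (trans (*-congˡ (geometric x n)) (*-identityʳ x)) ⟩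
    (1# - x) + x
      ≈⟨ [x-y]+y≈x 1# x ⟩
    1# ∎
    where
    s : Carrier
    s = sum {n} (λ i → x ^ toℕ i)

    factor : ∀ n (f : ℕ → Carrier) → sum {n} (λ i → x * f (toℕ i)) ≈ x * sum {n} (λ i → f (toℕ i))
    factor zero    f = sym (zeroʳ x)
    factor (suc n) f = trans (+-congˡ (factor n (λ i → f (suc i)))) (sym (distribˡ _ _ _))

  geometric-inverse : ∀ f n → f * sum {n} (λ i → (1# - f) ^ toℕ i) + (1# - f) ^ n ≈ 1#
  geometric-inverse f n = trans (+-congʳ (*-congʳ (sym 1-[1-f]≈f))) (geometric (1# - f) n)
    where
    1-[1-f]≈f : 1# - (1# - f) ≈ f
    1-[1-f]≈f = begin
      1# - (1# - f)               ≈⟨ +-congʳ ([x-y]+y≈x 1# f) ⟨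
      (1# - f) + f - (1# - f)     ≈⟨ trans (+-congʳ (+-comm _ _)) (+-assoc _ _ _) ⟩
      f + ((1# - f) - (1# - f))   ≈⟨ trans (+-congˡ (-‿inverseʳ _)) (+-identityʳ f) ⟩
      f                           ∎

  ^2^n≈^n*^n : ∀ x n → (x ^ 2) ^ n ≈ x ^ n * x ^ n
  ^2^n≈^n*^n x n = trans (^-distrib-* x (x * 1#) n)
    (*-congˡ (^-congˡ n (*-identityʳ x)))

  1^n≈1 : ∀ n → 1# ^ n ≈ 1#
  1^n≈1 zero    = refl
  1^n≈1 (suc n) = trans (*-identityˡ _) (1^n≈1 n)

  ^3^n≈^n*^n*^n : ∀ x n → (x ^ 3) ^ n ≈ x ^ n * x ^ n * x ^ n
  ^3^n≈^n*^n*^n x n = trans (^-distrib-* x (x ^ 2) n)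
    (trans (*-congˡ (^2^n≈^n*^n x n)) (sym (*-assoc _ _ _)))

  ^4^n≈^n*^n*^n*^n : ∀ x n → (x ^ 4) ^ n ≈ x ^ n * x ^ n * x ^ n * x ^ n
  ^4^n≈^n*^n*^n*^n x n = trans (^-distrib-* x (x ^ 3) n)
    (trans (*-congˡ (^3^n≈^n*^n*^n x n))
      (trans (sym (*-assoc _ _ _)) (*-congʳ (sym (*-assoc _ _ _)))))

  -- `N` and `N′` are the values of q to the number of parts without and with the new smallest part.
  -- That part has size m + 1 and the others are counted from base m + 1. On the right the whole
  -- partition is counted from base m.
  shift-power : ∀ q N h m {N′} → N′ ≈ q * N →
                q ^ suc m * (N ^ suc m * h) ≈ N′ ^ m * (q * N * h)
  shift-power q N h m {N′} p = begin
    q * q ^ m * (N * N ^ m * h)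
      ≈⟨ solve 5 (λ q x n z h → q :* x :* (n :* z :* h) := x :* z :* (q :* n :* h))
           refl q (q ^ m) N (N ^ m) h ⟩
    q ^ m * N ^ m * (q * N * h)   ≈⟨ *-congʳ (^-distrib-* q N m) ⟨
    (q * N) ^ m * (q * N * h)     ≈⟨ *-congʳ (^-congˡ m p) ⟨
    N′ ^ m * (q * N * h)          ∎

  q*A*B*C≈q*[A*B*C] : ∀ q A B C → q * A * B * C ≈ q * (A * B * C)
  q*A*B*C≈q*[A*B*C] = solve 4 (λ q a b c → q :* a :* b :* c := q :* (a :* b :* c)) refl

  A*[q*B]*C≈q*[A*B*C] : ∀ q A B C → A * (q * B) * C ≈ q * (A * B * C)
  A*[q*B]*C≈q*[A*B*C] = solve 4 (λ q a b c → a :* (q :* b) :* c := q :* (a :* b :* c)) refl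

  A*B*[q*C]≈q*[A*B*C] : ∀ q A B C → A * B * (q * C) ≈ q * (A * B * C)
  A*B*[q*C]≈q*[A*B*C] = solve 4 (λ q a b c → a :* b :* (q :* c) := q :* (a :* b :* c)) refl

  power-rec : ∀ N m h h′ s → h ≈ N * h′ + s → N ^ m * h ≈ N ^ suc m * h′ + N ^ m * s
  power-rec N m h h′ s p = trans (*-congˡ p)
    (solve 4 (λ n x h s → x :* (n :* h :+ s) := n :* x :* h :+ x :* s) refl N (N ^ m) h′ s)

  cons₁ : ∀ y z x₁ x₂ x₃ s → y * x₁ * x₂ * x₃ * (z * s) ≈ y * (z * (x₁ * x₂ * x₃ * s))
  cons₁ = solve 6 (λ y z x₁ x₂ x₃ s →
    y :* x₁ :* x₂ :* x₃ :* (z :* s) := y :* (z :* (x₁ :* x₂ :* x₃ :* s))) refl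

  cons₂ : ∀ y z x₁ x₂ x₃ s → x₁ * (y * x₂) * x₃ * (z * s) ≈ y * (z * (x₁ * x₂ * x₃ * s))
  cons₂ = solve 6 (λ y z x₁ x₂ x₃ s →
    x₁ :* (y :* x₂) :* x₃ :* (z :* s) := y :* (z :* (x₁ :* x₂ :* x₃ :* s))) refl

  cons₃ : ∀ y z x₁ x₂ x₃ s → x₁ * x₂ * (y * x₃) * (z * s) ≈ y * (z * (x₁ * x₂ * x₃ * s))
  cons₃ = solve 6 (λ y z x₁ x₂ x₃ s →
    x₁ :* x₂ :* (y :* x₃) :* (z :* s) := y :* (z :* (x₁ :* x₂ :* x₃ :* s))) refl

  form-a : ∀ A B C t → A * B * (C * C) * t ≈ A * B * C * C * t
  form-a = solve 4 (λ a b c t → a :* b :* (c :* c) :* t := a :* b :* c :* c :* t) refl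

  form-a′ : ∀ q A B C t → q * (A * A * A * (B * B * B) * (C * C) * t) ≈
            A * A * B * B * (q * C) * (A * B * C * t)
  form-a′ = solve 5 (λ q a b c t →
    q :* (a :* a :* a :* (b :* b :* b) :* (c :* c) :* t) :=
    a :* a :* b :* b :* (q :* c) :* (a :* b :* c :* t)) refl

  form-b : ∀ q A B C t → q * (A * A * A * A * (B * B) * (C * C * C) * t) ≈
           A * A * A * (q * B) * C * C * (A * B * C * t)
  form-b = solve 5 (λ q a b c t →
    q :* (a :* a :* a :* a :* (b :* b) :* (c :* c :* c) :* t) :=
    a :* a :* a :* (q :* b) :* c :* c :* (a :* b :* c :* t)) refl

  form-c : ∀ A B C t → A * A * A * B * (C * C) * t ≈ A * A * A * B * C * C * t
  form-c = solve 4 (λ a b c t → a :* a :* a :* b :* (c :* c) :* t := a :* a :* a :* b :* c :* c :* t) refl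

  form-d : ∀ A B C t → A * A * (B * B) * C * t ≈ A * A * B * B * C * t
  form-d = solve 4 (λ a b c t → a :* a :* (b :* b) :* c :* t := a :* a :* b :* b :* c :* t) refl

  xv*y*z≈x*y*z*v : ∀ x v y z → x * v * y * z ≈ x * y * z * v
  xv*y*z≈x*y*z*v = solve 4 (λ x v y z → x :* v :* y :* z := x :* y :* z :* v) refl

  x*yv*z≈x*y*z*v : ∀ x y v z → x * (y * v) * z ≈ x * y * z * v
  x*yv*z≈x*y*z*v = solve 4 (λ x y v z → x :* (y :* v) :* z := x :* y :* z :* v) refl

  invertible-cancelˡ : ∀ {f g x y} → f * g ≈ 1# → f * x ≈ f * y → x ≈ y
  invertible-cancelˡ {f} {g} {x} {y} fg≈1 p = begin
    x            ≈⟨ *-identityˡ x ⟨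
    1# * x       ≈⟨ *-congʳ fg≈1 ⟨
    f * g * x    ≈⟨ swap x ⟩
    g * (f * x)  ≈⟨ *-congˡ p ⟩
    g * (f * y)  ≈⟨ swap y ⟨
    f * g * y    ≈⟨ *-congʳ fg≈1 ⟩
    1# * y       ≈⟨ *-identityˡ y ⟩
    y            ∎
    where
    swap : ∀ z → f * g * z ≈ g * (f * z)
    swap z = solve 3 (λ f g z → f :* g :* z := g :* (f :* z)) refl f g z

  -- With t = e p i and t′ = e′ p′ i′ this is (1 - w) t′ = (1 + z) x t without subtraction.
  -- Multiplying (1 - w) t′ by `d * i`, which is 1, lets d (1 - w) = d′ cancel against i′.
  ratio : ∀ {e e′ x p p′ z d d′ i i′ w} →
          e′ ≈ e * x → p′ ≈ p * (1# + z) → d′ ≈ d * (1# - w) →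
          d * i ≈ 1# → d′ * i′ ≈ 1# →
          e′ * (p′ * i′) ≈ w * (e′ * (p′ * i′)) + (1# + z) * (x * (e * (p * i)))
  ratio {e} {e′} {x} {p} {p′} {z} {d} {d′} {i} {i′} {w} e≈ p≈ d≈ di≈1 d′i′≈1 = begin
    t′                              ≈⟨ *-identityˡ t′ ⟨
    1# * t′                         ≈⟨ *-congʳ ([x-y]+y≈x 1# w) ⟨
    ((1# - w) + w) * t′             ≈⟨ trans (distribʳ _ _ _) (+-comm _ _) ⟩
    w * t′ + (1# - w) * t′          ≈⟨ +-congˡ (begin
      (1# - w) * t′                       ≈⟨ trans (*-congˡ di≈1) (*-identityʳ _) ⟨
      (1# - w) * t′ * (d * i)             ≈⟨ solve 6 (λ v e p j d i →
                                               v :* (e :* (p :* j)) :* (d :* i)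
                                                 := (d :* v :* j) :* (e :* p :* i))
                                               refl (1# - w) e′ p′ i′ d i ⟩
      d * (1# - w) * i′ * (e′ * p′ * i)   ≈⟨ *-congʳ (trans (*-congʳ (sym d≈)) d′i′≈1) ⟩
      1# * (e′ * p′ * i)                  ≈⟨ *-identityˡ _ ⟩
      e′ * p′ * i                         ≈⟨ *-congʳ (*-cong e≈ p≈) ⟩
      e * x * (p * (1# + z)) * i          ≈⟨ solve 5 (λ e x p z i →
                                               e :* x :* (p :* z) :* i
                                                 := z :* (x :* (e :* (p :* i))))
                                               refl e x p (1# + z) i ⟩
      (1# + z) * (x * (e * (p * i)))      ∎) ⟩
    w * t′ + (1# + z) * (x * (e * (p * i)))  ∎
    where
    t′ : Carrier
    t′ = e′ * (p′ * i′)

  collect : ∀ e Y₁ u a Y₂ v b Y₃ w c p i →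
            e * ((Y₁ * u) ^ a * (Y₂ * v) ^ b * (Y₃ * w) ^ c * p * i) ≈
            Y₁ ^ a * (Y₂ ^ b * (Y₃ ^ c * ((u ^ a * v ^ b * w ^ c) * (e * (p * i)))))
  collect e Y₁ u a Y₂ v b Y₃ w c p i = begin
    e * ((Y₁ * u) ^ a * (Y₂ * v) ^ b * (Y₃ * w) ^ c * p * i)
      ≈⟨ *-congˡ (*-congʳ (*-congʳ (*-cong (*-cong
           (^-distrib-* Y₁ u a) (^-distrib-* Y₂ v b)) (^-distrib-* Y₃ w c)))) ⟩
    e * ((Y₁ ^ a * u ^ a) * (Y₂ ^ b * v ^ b) * (Y₃ ^ c * w ^ c) * p * i)
      ≈⟨ solve 9 (λ e Y₁ u Y₂ v Y₃ w p i →
           e :* ((Y₁ :* u) :* (Y₂ :* v) :* (Y₃ :* w) :* p :* i) :=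
           Y₁ :* (Y₂ :* (Y₃ :* ((u :* v :* w) :* (e :* (p :* i))))))
           refl e (Y₁ ^ a) (u ^ a) (Y₂ ^ b) (v ^ b) (Y₃ ^ c) (w ^ c) p i ⟩
    Y₁ ^ a * (Y₂ ^ b * (Y₃ ^ c * ((u ^ a * v ^ b * w ^ c) * (e * (p * i))))) ∎

  module Forms (A B C t P₁ P₂ P₃ : Carrier) where

    -- The coefficients of y₁ᵃy₂ᵇy₃ᶜ in the right-hand sides for Λ, Λ_{1_R},
    -- Λ_{1_R,2_R,1_B} and Λ_{1_R,1_G}, in this order.
    hᵃ hᵇ hᶜ hᵈ : Carrier
    hᵃ = A * B * C * C * t + A * A * B * B * C * P₃
    hᵇ = A * A * B * B * C * t + A * A * A * B * C * C * P₂
    hᶜ = A * A * A * B * C * C * t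
    hᵈ = A * A * B * B * C * t

    module Recurrence
      (rel₁ : t ≈ A * A * t + (1# + A * B * C) * P₁)
      (rel₂ : t ≈ B * B * t + (1# + A * B * C) * P₂)
      (rel₃ : t ≈ C * C * t + (1# + A * B * C) * P₃)
      where

      -- Expand `t` by `rel₃`. The term in C² t and the part ABC of the factor 1 + ABC make up ABC
      -- times `hᵃ`; the part 1 of that factor is the contribution of a blue part.
      hᵈ-rec : hᵈ ≈ A * B * C * hᵃ + A * B * C * (A * B * P₃)
      hᵈ-rec = trans (*-congˡ rel₃) (solve 5 (λ a b c t p →
        a :* a :* b :* b :* c :* (c :* c :* t :+ (con 1 :+ a :* b :* c) :* p) :=
        a :* b :* c :* (a :* b :* c :* c :* t :+ a :* a :* b :* b :* c :* p)
          :+ a :* b :* c :* (a :* b :* p)) refl A B C t P₃)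

      -- `hᵇ` exceeds `hᵈ` by a single term in `P₂`, and this term already is the contribution of a
      -- green part.
      hᵇ-rec : hᵇ ≈ A * B * C * hᵃ + (A * B * C * (A * A * C * P₂) + A * B * C * (A * B * P₃))
      hᵇ-rec = trans (+-congʳ hᵈ-rec) (solve 6 (λ a b c h p₂ p₃ →
        a :* b :* c :* h :+ a :* b :* c :* (a :* b :* p₃) :+ a :* a :* a :* b :* c :* c :* p₂ :=
        a :* b :* c :* h :+ (a :* b :* c :* (a :* a :* c :* p₂) :+ a :* b :* c :* (a :* b :* p₃)))
        refl A B C hᵃ P₂ P₃)

      hᶜ-rec : hᶜ ≈ A * B * C * hᵇ + A * B * C * (A * A * C * P₂)
      hᶜ-rec = trans (*-congˡ rel₂) (solve 5 (λ a b c t p →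
        a :* a :* a :* b :* c :* c :* (b :* b :* t :+ (con 1 :+ a :* b :* c) :* p) :=
        a :* b :* c :* (a :* a :* b :* b :* c :* t :+ a :* a :* a :* b :* c :* c :* p)
          :+ a :* b :* c :* (a :* a :* c :* p)) refl A B C t P₂)

      -- Multiplied by 1 + A B C, both sides become C t + A B t.
      key : (∀ {x y} → (1# + A * B * C) * x ≈ (1# + A * B * C) * y → x ≈ y) →
            C * t + A * B * P₃ ≈ A * B * t + A * A * C * P₂ + C * P₁
      key cancel = cancel (begin
        (1# + A * B * C) * (C * t + A * B * P₃)
          ≈⟨ solve 5 (λ a b c t p →
               (con 1 :+ a :* b :* c) :* (c :* t :+ a :* b :* p) :=
               c :* t :+ a :* b :* (c :* c :* t :+ (con 1 :+ a :* b :* c) :* p))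
               refl A B C t P₃ ⟩
        C * t + A * B * (C * C * t + (1# + A * B * C) * P₃)
          ≈⟨ +-cong (*-congˡ rel₁) (*-congˡ (sym rel₃)) ⟩
        C * (A * A * t + (1# + A * B * C) * P₁) + A * B * t
          ≈⟨ +-congʳ (*-congˡ (+-congʳ (*-congˡ rel₂))) ⟩
        C * (A * A * (B * B * t + (1# + A * B * C) * P₂) + (1# + A * B * C) * P₁) + A * B * t
          ≈⟨ solve 6 (λ a b c t p₁ p₂ →
               c :* (a :* a :* (b :* b :* t :+ (con 1 :+ a :* b :* c) :* p₂)
                     :+ (con 1 :+ a :* b :* c) :* p₁) :+ a :* b :* t :=
               (con 1 :+ a :* b :* c) :* (a :* b :* t :+ a :* a :* c :* p₂ :+ c :* p₁))
               refl A B C t P₁ P₂ ⟩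
        (1# + A * B * C) * (A * B * t + A * A * C * P₂ + C * P₁) ∎)

      -- The identity `k` turns `hᵃ` into the contribution of a red part plus `hᵇ`: a partition in Λ
      -- either contains 1_R or avoids it. The recurrence for `hᵇ` then finishes the argument.
      hᵃ-rec : C * t + A * B * P₃ ≈ A * B * t + A * A * C * P₂ + C * P₁ →
               hᵃ ≈ A * B * C * hᵃ + (A * B * C * (C * P₁)
                      + (A * B * C * (A * A * C * P₂) + A * B * C * (A * B * P₃)))
      hᵃ-rec k = begin
        A * B * C * C * t + A * A * B * B * C * P₃
          ≈⟨ solve 5 (λ a b c t p →
               a :* b :* c :* c :* t :+ a :* a :* b :* b :* c :* p :=
               a :* b :* c :* (c :* t :+ a :* b :* p)) refl A B C t P₃ ⟩
        A * B * C * (C * t + A * B * P₃)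
          ≈⟨ *-congˡ k ⟩
        A * B * C * (A * B * t + A * A * C * P₂ + C * P₁)
          ≈⟨ solve 6 (λ a b c t p₁ p₂ →
               a :* b :* c :* (a :* b :* t :+ a :* a :* c :* p₂ :+ c :* p₁) :=
               a :* b :* c :* (c :* p₁)
                 :+ (a :* a :* b :* b :* c :* t :+ a :* a :* a :* b :* c :* c :* p₂))
               refl A B C t P₁ P₂ ⟩
        A * B * C * (C * P₁) + hᵇ
          ≈⟨ +-congˡ hᵇ-rec ⟩
        A * B * C * (C * P₁) + (A * B * C * hᵃ + (A * B * C * (A * A * C * P₂) + A * B * C * (A * B * P₃)))
          ≈⟨ solve 3 (λ x y z → x :+ (y :+ z) := y :+ (x :+ z)) refl _ _ _ ⟩
        A * B * C * hᵃ + (A * B * C * (C * P₁)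
          + (A * B * C * (A * A * C * P₂) + A * B * C * (A * B * P₃))) ∎

  1*1*x+y*0≈x : ∀ x y → 1# * 1# * x + y * 0# ≈ x
  1*1*x+y*0≈x = solve 2 (λ x y → con 1 :* con 1 :* x :+ y :* con 0 := x) refl

  key-origin : ∀ t → 1# * t + 1# * 1# * 0# ≈ 1# * 1# * t + 1# * 1# * 1# * 0# + 1# * 0#
  key-origin = solve 1 (λ t →
    con 1 :* t :+ con 1 :* con 1 :* con 0 :=
    con 1 :* con 1 :* t :+ con 1 :* con 1 :* con 1 :* con 0 :+ con 1 :* con 0) refl

  shift₁ : ∀ q A B C t → q * (A * B * C) * (A * A * A * B * C * C * t) ≈
           q * A * B * C * (C * (A * A * A * B * C * t))
  shift₁ = solve 5 (λ q a b c t →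
    q :* (a :* b :* c) :* (a :* a :* a :* b :* c :* c :* t) :=
    q :* a :* b :* c :* (c :* (a :* a :* a :* b :* c :* t))) refl

  shift₂ : ∀ q A B C t → q * (A * B * C) * (A * A * A * B * C * C * t) ≈
           A * (q * B) * C * (A * A * C * (A * B * C * t))
  shift₂ = solve 5 (λ q a b c t →
    q :* (a :* b :* c) :* (a :* a :* a :* b :* c :* c :* t) :=
    a :* (q :* b) :* c :* (a :* a :* c :* (a :* b :* c :* t))) refl

  shift₃ : ∀ q A B C t → q * (A * B * C) * (A * A * B * B * C * t) ≈
           A * B * (q * C) * (A * B * (A * B * C * t))
  shift₃ = solve 5 (λ q a b c t →
    q :* (a :* b :* c) :* (a :* a :* b :* b :* c :* t) :=
    a :* b :* (q :* c) :* (a :* b :* (a :* b :* c :* t))) refl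

  module _ {t : Carrier} (t≈1 : t ≈ 1#) where

    open Forms 1# 1# 1# t 0# 0# 0#

    hᵃ-origin : hᵃ ≈ 1#
    hᵃ-origin = trans (solve 1 (λ t → con 1 :* con 1 :* con 1 :* con 1 :* t
      :+ con 1 :* con 1 :* con 1 :* con 1 :* con 1 :* con 0 := t) refl t) t≈1

    hᵇ-origin : hᵇ ≈ 1#
    hᵇ-origin = trans (solve 1 (λ t → con 1 :* con 1 :* con 1 :* con 1 :* con 1 :* t
      :+ con 1 :* con 1 :* con 1 :* con 1 :* con 1 :* con 1 :* con 0 := t) refl t) t≈1

    hᶜ-origin : hᶜ ≈ 1#
    hᶜ-origin = trans (solve 1 (λ t → con 1 :* con 1 :* con 1 :* con 1 :* con 1 :* con 1 :* t
      := t) refl t) t≈1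

    hᵈ-origin : hᵈ ≈ 1#
    hᵈ-origin = trans (solve 1 (λ t → con 1 :* con 1 :* con 1 :* con 1 :* con 1 :* t := t) refl t) t≈1

  1*[1*x]≈1*1*1*x : ∀ x → 1# * (1# * x) ≈ 1# * 1# * 1# * x
  1*[1*x]≈1*1*1*x = solve 1 (λ x →
    con 1 :* (con 1 :* x) := con 1 :* con 1 :* con 1 :* x) refl

  *-cancel-zero : ∀ x y → x * (y * 0#) ≈ 0#
  *-cancel-zero x y = trans (*-congˡ (zeroʳ y)) (zeroʳ x)

open import Defs using (module Series)

-- The ring of formal power series

module SeriesRing (𝓡 : RawRing 0ℓ 0ℓ) (isCommutative : IsCommutative 𝓡) where

  open CommutativeRing (bundle {𝓡} isCommutative) hiding (rawRing)
  open RawSemiringDefs (RawRing.rawSemiring 𝓡) using (_^_; sum)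
  module S = Series 𝓡
  open S public using (X; const)
  module Raw = RawRing S.rawRing⟦X⟧
  open CommutativeSemigroupProps +-commutativeSemigroup using (interchange)
  open SetoidReasoning setoid

  infixl 7 _⊛_
  infix  4 _≈ˢ_
  infixl 6 _⊕_
  infixr 8 _^ˢ_

  Ser : Set
  Ser = ℕ → Carrier

  _⊛_ _⊕_ : Ser → Ser → Ser
  _⊛_ = Raw._*_
  _⊕_ = Raw._+_

  _≈ˢ_ : Ser → Ser → Set
  _≈ˢ_ = Raw._≈_

  _^ˢ_ : Ser → ℕ → Ser
  _^ˢ_ = RawSemiringDefs._^_ Raw.rawSemiring

  infixr 7 _·_
  _·_ : Carrier → Ser → Ser
  (r · f) n = r * f n

  -- The convolution `(f ⊛ g) (suc n)` unfolds by computation to `f 0 * g (suc n) + (tail f ⊛ g) n`.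
  -- The ring laws below are inductions on the index along this equation.
  tail : Ser → Ser
  tail f n = f (suc n)

  ⊛-cong : ∀ {f f′ g g′} → f ≈ˢ f′ → g ≈ˢ g′ → f ⊛ g ≈ˢ f′ ⊛ g′
  ⊛-cong p p′ zero    = +-congʳ (*-cong (p 0) (p′ 0))
  ⊛-cong p p′ (suc n) =
    +-cong (*-cong (p 0) (p′ (suc n))) (⊛-cong (λ i → p (suc i)) p′ n)

  ⊛-distribʳ : ∀ h f g → (f ⊕ g) ⊛ h ≈ˢ (f ⊛ h) ⊕ (g ⊛ h)
  ⊛-distribʳ h f g zero    = begin
    (f 0 + g 0) * h 0 + 0#                ≈⟨ +-cong (distribʳ _ _ _) (sym (+-identityʳ _)) ⟩
    (f 0 * h 0 + g 0 * h 0) + (0# + 0#)   ≈⟨ interchange _ _ _ _ ⟩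
    (f 0 * h 0 + 0#) + (g 0 * h 0 + 0#)   ∎
  ⊛-distribʳ h f g (suc n) =
    trans (+-cong (distribʳ _ _ _) (⊛-distribʳ h (tail f) (tail g) n)) (interchange _ _ _ _)

  ·-⊛ : ∀ r f g → (r · f) ⊛ g ≈ˢ r · (f ⊛ g)
  ·-⊛ r f g zero    = begin
    r * f 0 * g 0 + 0#        ≈⟨ +-cong (*-assoc _ _ _) (sym (zeroʳ r)) ⟩
    r * (f 0 * g 0) + r * 0#  ≈⟨ distribˡ _ _ _ ⟨
    r * (f 0 * g 0 + 0#)      ∎
  ·-⊛ r f g (suc n) =
    trans (+-cong (*-assoc _ _ _) (·-⊛ r (tail f) g n)) (sym (distribˡ _ _ _))

  ⊛-zeroˡ : ∀ f g → f ≈ˢ Raw.0# → f ⊛ g ≈ˢ Raw.0#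
  ⊛-zeroˡ f g p zero    = trans (+-identityʳ _) (trans (*-congʳ (p 0)) (zeroˡ _))
  ⊛-zeroˡ f g p (suc n) = trans
    (+-cong (trans (*-congʳ (p 0)) (zeroˡ _)) (⊛-zeroˡ (tail f) g (λ i → p (suc i)) n))
    (+-identityʳ 0#)

  -- Computation peels off `f 0`; peeling off `g 0` at the other end needs an induction.
  -- Commutativity compares the two ends.
  ⊛-sucʳ : ∀ f g n → (f ⊛ g) (suc n) ≈ (f ⊛ tail g) n + f (suc n) * g 0
  ⊛-sucʳ f g zero    = trans (+-congˡ (+-identityʳ _)) (+-congʳ (sym (+-identityʳ _)))
  ⊛-sucʳ f g (suc n) = trans (+-congˡ (⊛-sucʳ (tail f) g n)) (sym (+-assoc _ _ _))

  ⊛-comm : ∀ f g → f ⊛ g ≈ˢ g ⊛ f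
  ⊛-comm f g zero    = +-congʳ (*-comm _ _)
  ⊛-comm f g (suc n) = begin
    f 0 * g (suc n) + (tail f ⊛ g) n   ≈⟨ +-cong (*-comm _ _) (⊛-comm (tail f) g n) ⟩
    g (suc n) * f 0 + (g ⊛ tail f) n   ≈⟨ +-comm _ _ ⟩
    (g ⊛ tail f) n + g (suc n) * f 0   ≈⟨ ⊛-sucʳ g f n ⟨
    (g ⊛ f) (suc n)                    ∎

  ⊛-assoc : ∀ f g h → (f ⊛ g) ⊛ h ≈ˢ f ⊛ (g ⊛ h)
  ⊛-assoc f g h zero    = +-congʳ (begin
    (f 0 * g 0 + 0#) * h 0   ≈⟨ *-congʳ (+-identityʳ _) ⟩
    f 0 * g 0 * h 0          ≈⟨ *-assoc _ _ _ ⟩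
    f 0 * (g 0 * h 0)        ≈⟨ *-congˡ (+-identityʳ _) ⟨
    f 0 * (g 0 * h 0 + 0#)   ∎)
  -- The tail of `f ⊛ g` is `(f 0 · tail g) ⊕ (tail f ⊛ g)`, which brings in distributivity and the
  -- scalar law.
  ⊛-assoc f g h (suc n) = begin
    (f 0 * g 0 + 0#) * h (suc n) + (((f 0 · tail g) ⊕ (tail f ⊛ g)) ⊛ h) n
      ≈⟨ +-cong (trans (*-congʳ (+-identityʳ _)) (*-assoc _ _ _))
                (⊛-distribʳ h (f 0 · tail g) (tail f ⊛ g) n) ⟩
    f 0 * (g 0 * h (suc n)) + (((f 0 · tail g) ⊛ h) n + ((tail f ⊛ g) ⊛ h) n)
      ≈⟨ +-congˡ (+-cong (·-⊛ (f 0) (tail g) h n) (⊛-assoc (tail f) g h n)) ⟩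
    f 0 * (g 0 * h (suc n)) + (f 0 * (tail g ⊛ h) n + (tail f ⊛ (g ⊛ h)) n)
      ≈⟨ +-assoc _ _ _ ⟨
    f 0 * (g 0 * h (suc n)) + f 0 * (tail g ⊛ h) n + (tail f ⊛ (g ⊛ h)) n
      ≈⟨ +-congʳ (distribˡ _ _ _) ⟨
    f 0 * (g ⊛ h) (suc n) + (tail f ⊛ (g ⊛ h)) n  ∎

  const-⊛ : ∀ r f → const r ⊛ f ≈ˢ r · f
  const-⊛ r f zero    = +-identityʳ _
  const-⊛ r f (suc n) =
    trans (+-congˡ (⊛-zeroˡ (tail (const r)) f (λ _ → refl) n)) (+-identityʳ _)

  1≈const : Raw.1# ≈ˢ const 1#
  1≈const zero    = refl
  1≈const (suc n) = refl

  ⊛-identityˡ : ∀ f → Raw.1# ⊛ f ≈ˢ f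
  ⊛-identityˡ f n = begin
    (Raw.1# ⊛ f) n    ≈⟨ ⊛-cong {g = f} 1≈const (λ _ → refl) n ⟩
    (const 1# ⊛ f) n  ≈⟨ const-⊛ 1# f n ⟩
    1# * f n          ≈⟨ *-identityˡ _ ⟩
    f n               ∎

  isCommutative⟦X⟧ : IsCommutative S.rawRing⟦X⟧
  isCommutative⟦X⟧ = record
    { isRing = record
      { +-isAbelianGroup = record
        { isGroup = record
          { isMonoid = record
            { isSemigroup = record
              { isMagma = record
                { isEquivalence = record
                  { refl  = λ _ → refl
                  ; sym   = λ p n → sym (p n)
                  ; trans = λ p p′ n → trans (p n) (p′ n)
                  }
                ; ∙-cong = λ p p′ n → +-cong (p n) (p′ n)
                }
              ; assoc = λ f g h n → +-assoc (f n) (g n) (h n)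
              }
            ; identity = (λ f n → +-identityˡ (f n)) , (λ f n → +-identityʳ (f n))
            }
          ; inverse = (λ f n → -‿inverseˡ (f n)) , (λ f n → -‿inverseʳ (f n))
          ; ⁻¹-cong = λ p n → -‿cong (p n)
          }
        ; comm = λ f g n → +-comm (f n) (g n)
        }
      ; *-cong     = ⊛-cong
      ; *-assoc    = ⊛-assoc
      ; *-identity = ⊛-identityˡ , λ f n → trans (⊛-comm f Raw.1# n) (⊛-identityˡ f n)
      ; distrib    =
          (λ f g h n → trans (⊛-comm f (g ⊕ h) n) (trans (⊛-distribʳ f g h n)
            (+-cong (⊛-comm g f n) (⊛-comm h f n))))
        , ⊛-distribʳ
      }
    ; *-comm = ⊛-comm
    }

  X-⊛-zero : ∀ f → (X ⊛ f) 0 ≈ 0#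
  X-⊛-zero f = trans (+-identityʳ _) (zeroˡ _)

  X-⊛-suc : ∀ f n → (X ⊛ f) (suc n) ≈ f n
  X-⊛-suc f n = begin
    0# * f (suc n) + (tail X ⊛ f) n  ≈⟨ +-cong (zeroˡ _) (⊛-cong {g = f} tailX (λ _ → refl) n) ⟩
    0# + (Raw.1# ⊛ f) n              ≈⟨ +-identityˡ _ ⟩
    (Raw.1# ⊛ f) n                   ≈⟨ ⊛-identityˡ f n ⟩
    f n                              ∎
    where
    tailX : tail X ≈ˢ Raw.1#
    tailX zero    = refl
    tailX (suc _) = refl

  const-cong : ∀ {r s} → r ≈ s → const r ≈ˢ const s
  const-cong p zero    = p
  const-cong p (suc _) = refl

  const-* : ∀ r s → const (r * s) ≈ˢ const r ⊛ const s
  const-* r s n = trans (lemma n) (sym (const-⊛ r (const s) n))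
    where
    lemma : const (r * s) ≈ˢ r · const s
    lemma zero    = refl
    lemma (suc _) = sym (zeroʳ r)

  const-^ : ∀ r n → const (r ^ n) ≈ˢ const r ^ˢ n
  const-^ r zero    i = sym (1≈const i)
  const-^ r (suc n) i = trans (const-* r (r ^ n) i)
    (⊛-cong {const r} {const r} (λ _ → refl) (const-^ r n) i)

  X^-⊛-const : ∀ n r → (X ^ˢ n ⊛ const r) n ≈ r
  X^-⊛-const zero    r = ⊛-identityˡ (const r) 0
  X^-⊛-const (suc n) r = begin
    (X ⊛ X ^ˢ n ⊛ const r) (suc n)    ≈⟨ ⊛-assoc X (X ^ˢ n) (const r) (suc n) ⟩
    (X ⊛ (X ^ˢ n ⊛ const r)) (suc n)  ≈⟨ X-⊛-suc (X ^ˢ n ⊛ const r) n ⟩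
    (X ^ˢ n ⊛ const r) n              ≈⟨ X^-⊛-const n r ⟩
    r                                 ∎

  X^-⊛-const-≢ : ∀ {m n} r → m ≢ n → (X ^ˢ n ⊛ const r) m ≈ 0#
  X^-⊛-const-≢ {zero}  {zero}  r m≢n = contradiction ≡.refl m≢n
  X^-⊛-const-≢ {suc m} {zero}  r m≢n = ⊛-identityˡ (const r) (suc m)
  X^-⊛-const-≢ {zero}  {suc n} r m≢n =
    trans (⊛-assoc X (X ^ˢ n) (const r) 0) (X-⊛-zero (X ^ˢ n ⊛ const r))
  X^-⊛-const-≢ {suc m} {suc n} r m≢n = begin
    (X ⊛ X ^ˢ n ⊛ const r) (suc m)    ≈⟨ ⊛-assoc X (X ^ˢ n) (const r) (suc m) ⟩
    (X ⊛ (X ^ˢ n ⊛ const r)) (suc m)  ≈⟨ X-⊛-suc (X ^ˢ n ⊛ const r) m ⟩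
    (X ^ˢ n ⊛ const r) m              ≈⟨ X^-⊛-const-≢ r (λ m≡n → m≢n (≡.cong suc m≡n)) ⟩
    0#                                ∎

-- Filtrations by degree

record Filtration (𝓡 : RawRing 0ℓ 0ℓ) : Set₁ where
  open RawRing 𝓡
  field
    F      : ℕ → Carrier → Set
    F-resp : ∀ {n x y} → x ≈ y → F n x → F n y
    F-mono : ∀ {m n x} → m ≤ n → F n x → F m x
    F-0    : ∀ {n} → F n 0#
    F-+    : ∀ {n x y} → F n x → F n y → F n (x + y)
    F-*    : ∀ {m n x y} → F m x → F n y → F (m ℕ.+ n) (x * y)

-- The filtration for which X has degree 1.
filtration⟦X⟧ : ∀ {𝓡} → Filtration 𝓡 → Filtration (Series.rawRing⟦X⟧ 𝓡)
filtration⟦X⟧ {𝓡} 𝓕 = record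
  { F      = F′
  ; F-resp = λ p f∈ i → F-resp (p i) (f∈ i)
  ; F-mono = λ m≤n f∈ i → F-mono (ℕ.∸-monoˡ-≤ i m≤n) (f∈ i)
  ; F-0    = λ _ → F-0
  ; F-+    = λ f∈ g∈ i → F-+ (f∈ i) (g∈ i)
  ; F-*    = λ {m} {n} {f} {g} f∈ g∈ i → ⊛∈ m n f g f∈ g∈ i
  }
  where
  open Filtration 𝓕
  open RawRing (Series.rawRing⟦X⟧ 𝓡) using () renaming (Carrier to Ser; _*_ to _⊛_)

  tail : Ser → Ser
  tail f n = f (suc n)

  -- `F n x` reads as: x has degree at least n. The coefficient of Xⁱ must then have degree at least
  -- n - i, and truncated subtraction leaves the condition `F 0` once i reaches n.
  F′ : ℕ → Ser → Set
  F′ n f = ∀ i → F (n ℕ.∸ i) (f i)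

  ⊛∈ : ∀ m n f g → F′ m f → F′ n g → F′ (m ℕ.+ n) (f ⊛ g)
  ⊛∈ m n f g f∈ g∈ zero    = F-+ (F-* (f∈ 0) (g∈ 0)) F-0
  ⊛∈ m n f g f∈ g∈ (suc i) = F-+
    (F-mono (ℕ.≤-trans (ℕ.∸-monoˡ-≤ (suc i) (ℕ.+-monoʳ-≤ m (ℕ.m≤n+m∸n n (suc i)))) (bound m (suc i) _))
      (F-* (f∈ 0) (g∈ (suc i))))
    (tail∈ m f∈)
    where
    bound : ∀ m k l → m ℕ.+ (k ℕ.+ l) ℕ.∸ k ≤ m ℕ.+ l
    bound m k l = ℕ.≤-reflexive (≡.trans (ℕ.+-∸-assoc m (ℕ.m≤m+n k l))
      (≡.cong (m ℕ.+_) (ℕ.m+n∸m≡n k l)))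

    -- Passing to `tail f` lowers the degree by 1. For m = 0 truncated subtraction keeps it at 0,
    -- and monotonicity makes up the difference in the total.
    tail∈ : ∀ m → F′ m f → F (m ℕ.+ n ℕ.∸ suc i) ((tail f ⊛ g) i)
    tail∈ zero    f∈ = F-mono (ℕ.∸-monoʳ-≤ n (ℕ.n≤1+n i))
      (⊛∈ 0 n (tail f) g (λ j → F-mono (ℕ.≤-reflexive (ℕ.0∸n≡0 j)) (f∈ (suc j))) g∈ i)
    tail∈ (suc m) f∈ = ⊛∈ m n (tail f) g (λ j → f∈ (suc j)) g∈ i

open import Defs

-- Power series in y₁, y₂, y₃, q

module R₀ = SeriesRing ℤ.+-*-rawRing (CommutativeRing.isCommutativeRing ℤ.+-*-commutativeRing)
module R₃ = SeriesRing Sq.rawRing⟦X⟧ R₀.isCommutative⟦X⟧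
module R₂ = SeriesRing S₃.rawRing⟦X⟧ R₃.isCommutative⟦X⟧
module R₁ = SeriesRing S₂.rawRing⟦X⟧ R₂.isCommutative⟦X⟧

powerSeriesRing : CommutativeRing 0ℓ 0ℓ
powerSeriesRing = bundle {S₁.rawRing⟦X⟧} R₁.isCommutative⟦X⟧

module PS = CommutativeRing powerSeriesRing
module PSI = RingIdentities S₁.rawRing⟦X⟧ R₁.isCommutative⟦X⟧
module PS-Reasoning = SetoidReasoning PS.setoid

totalDegree : Filtration S₁.rawRing⟦X⟧
totalDegree = filtration⟦X⟧ (filtration⟦X⟧ (filtration⟦X⟧ (filtration⟦X⟧ trivial)))
  where
  F* : ∀ m n {x y} → (1 ≤ m → x ≡ 0ℤ) → (1 ≤ n → y ≡ 0ℤ) → 1 ≤ m ℕ.+ n → x ℤ.* y ≡ 0ℤ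
  F* zero    n       {x} {y} x∈ y∈ p = ≡.trans (≡.cong (x ℤ.*_) (y∈ p)) (ℤ.*-zeroʳ x)
  F* (suc m) n       {x} {y} x∈ y∈ p = ≡.cong (ℤ._* y) (x∈ (s≤s z≤n))

  -- Integers have degree 0, so 0 is the only one of degree at least 1.
  trivial : Filtration ℤ.+-*-rawRing
  trivial = record
    { F      = λ n x → 1 ≤ n → x ≡ 0ℤ
    ; F-resp = λ x≡y x∈ p → ≡.trans (≡.sym x≡y) (x∈ p)
    ; F-mono = λ m≤n x∈ p → x∈ (ℕ.≤-trans p m≤n)
    ; F-0    = λ _ → ≡.refl
    ; F-+    = λ x∈ y∈ p → ≡.cong₂ ℤ._+_ (x∈ p) (y∈ p)
    ; F-*    = λ {m} {n} → F* m n
    }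

module Deg = Filtration totalDegree

-- The nested truncated differences are what `Deg.F n` unfolds to. This and the converse show that
-- `Deg.F n f` means that all coefficients of `f` of total degree below n vanish.
totalDegree⁻ : ∀ n a b c d → 1 ≤ n ℕ.∸ a ℕ.∸ b ℕ.∸ c ℕ.∸ d → a ℕ.+ b ℕ.+ c ℕ.+ d < n
totalDegree⁻ n a b c d p rewrite ℕ.∸-+-assoc n a b | ℕ.∸-+-assoc n (a ℕ.+ b) c
                               | ℕ.∸-+-assoc n (a ℕ.+ b ℕ.+ c) d =
  ℕ.m∸n≢0⇒n<m λ eq → ℕ.<-irrefl (≡.sym eq) p

totalDegree⁺ : ∀ n a b c d → a ℕ.+ b ℕ.+ c ℕ.+ d < n → 1 ≤ n ℕ.∸ a ℕ.∸ b ℕ.∸ c ℕ.∸ d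
totalDegree⁺ n a b c d p rewrite ℕ.∸-+-assoc n a b | ℕ.∸-+-assoc n (a ℕ.+ b) c
                               | ℕ.∸-+-assoc n (a ℕ.+ b ℕ.+ c) d = ℕ.m<n⇒0<n∸m p

-- Infinite sums and multiplicative inverses

sumTo : ℕ → (ℕ → ℤ) → ℤ
sumTo zero    h = 0ℤ
sumTo (suc n) h = h 0 ℤ.+ sumTo n (λ k → h (suc k))

coeff-sum : ∀ n (F : ℕ → PowerSeries) a b c d →
            sum {n} (λ k → F (toℕ k)) a b c d ≡ sumTo n (λ k → F k a b c d)
coeff-sum zero    F a b c d = ≡.refl
coeff-sum (suc n) F a b c d =
  ≡.cong (ℤ._+_ (F 0 a b c d)) (coeff-sum n (λ k → F (suc k)) a b c d)

coeff-∑∞ : ∀ F a b c d →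
           ∑∞ F a b c d ≡ sumTo (suc (a ℕ.+ b ℕ.+ c ℕ.+ d)) (λ k → F k a b c d)
coeff-∑∞ F a b c d = coeff-sum (suc (a ℕ.+ b ℕ.+ c ℕ.+ d)) F a b c d

sumTo-zero : ∀ n {h} → (∀ k → h k ≡ 0ℤ) → sumTo n h ≡ 0ℤ
sumTo-zero zero    p = ≡.refl
sumTo-zero (suc n) p = ≡.cong₂ ℤ._+_ (p 0) (sumTo-zero n (λ k → p (suc k)))

sumTo-cong : ∀ n {h h′} → (∀ k → h k ≡ h′ k) → sumTo n h ≡ sumTo n h′
sumTo-cong zero    p = ≡.refl
sumTo-cong (suc n) p = ≡.cong₂ ℤ._+_ (p 0) (sumTo-cong n (λ k → p (suc k)))

sumTo-extend : ∀ {m n h} → m ≤ n → (∀ k → m ≤ k → h k ≡ 0ℤ) → sumTo m h ≡ sumTo n h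
sumTo-extend {n = n} z≤n       p = ≡.sym (sumTo-zero n (λ k → p k z≤n))
sumTo-extend {h = h} (s≤s m≤n) p =
  ≡.cong (ℤ._+_ (h 0)) (sumTo-extend m≤n (λ k m≤k → p (suc k) (s≤s m≤k)))

sumTo-single : ∀ {m n h} → m < n → (∀ k → k ≢ m → h k ≡ 0ℤ) → sumTo n h ≡ h m
sumTo-single {zero}  {suc n} {h} _         p = ≡.trans
  (≡.cong (ℤ._+_ (h 0)) (sumTo-zero n (λ k → p (suc k) λ ()))) (ℤ.+-identityʳ (h 0))
sumTo-single {suc m} {suc n} {h} (s≤s m<n) p = ≡.trans
  (≡.cong₂ ℤ._+_ (p 0 λ ()) (sumTo-single m<n (λ k k≢m → p (suc k) (λ eq → k≢m (ℕ.suc-injective eq)))))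
  (ℤ.+-identityˡ _)

constantTerm : PowerSeries → ℤ
constantTerm f = f 0 0 0 0

constantTerm-* : ∀ f g → constantTerm (f * g) ≡ constantTerm f ℤ.* constantTerm g
constantTerm-* f g = ≡.trans (ℤ.+-identityʳ _) (≡.trans (ℤ.+-identityʳ _)
  (≡.trans (ℤ.+-identityʳ _) (ℤ.+-identityʳ _)))

∈Deg1 : ∀ {f} → constantTerm f ≡ 0ℤ → Deg.F 1 f
∈Deg1 f≡0 zero    zero    zero    zero    _ = f≡0
∈Deg1 f≡0 zero    zero    zero    (suc d) p = contradiction (totalDegree⁻ 1 0 0 0 (suc d) p) λ { (s≤s ()) }
∈Deg1 f≡0 zero    zero    (suc c) d       p = contradiction (totalDegree⁻ 1 0 0 (suc c) d p) λ { (s≤s ()) }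
∈Deg1 f≡0 zero    (suc b) c       d       p = contradiction (totalDegree⁻ 1 0 (suc b) c d p) λ { (s≤s ()) }
∈Deg1 f≡0 (suc a) b       c       d       p = contradiction (totalDegree⁻ 1 (suc a) b c d p) λ { (s≤s ()) }

^∈Deg : ∀ {u} → Deg.F 1 u → ∀ n → Deg.F n (u ^ n)
^∈Deg u∈ zero    a b c d p = contradiction (totalDegree⁻ 0 a b c d p) λ ()
^∈Deg u∈ (suc n) = Deg.F-* u∈ (^∈Deg u∈ n)

∑∞-truncate : ∀ {F} → (∀ k → Deg.F k (F k)) → ∀ n →
              Deg.F n (∑∞ F - sum {n} (λ k → F (toℕ k)))
∑∞-truncate {F} F∈ n a b c d p = ≡.trans
  (≡.cong (λ z → ∑∞ F a b c d ℤ.+ ℤ.- z) eq) (ℤ.+-inverseʳ (∑∞ F a b c d))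
  where
  eq : sum {n} (λ k → F (toℕ k)) a b c d ≡ ∑∞ F a b c d
  eq = ≡.trans (coeff-sum n F a b c d) (≡.trans
    (≡.sym (sumTo-extend (totalDegree⁻ n a b c d p)
      (λ k lt → F∈ k a b c d (totalDegree⁺ k a b c d lt))))
    (≡.sym (coeff-∑∞ F a b c d)))

-- Fix one coefficient and let n exceed its total degree by 1. With g the truncated geometric series
-- and r the rest of the inverse, both `f * r` and `u ^ n` vanish at that coefficient. Exchanging
-- one for the other turns `f * g + f * r` into the exact finite identity.
⁻¹-inverseʳ : ∀ {f} → constantTerm f ≡ 1ℤ → f * f ⁻¹ ≈ 1#
⁻¹-inverseʳ {f} f≡1 a b c d = ≡.trans (split a b c d) (≡.trans
  (≡.cong (ℤ._+_ ((f * g) a b c d)) (≡.trans (f*r∈ a b c d n∈) (≡.sym (u^n∈ a b c d n∈))))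
  (main a b c d))
  where
  n : ℕ
  n = suc (a ℕ.+ b ℕ.+ c ℕ.+ d)

  n∈ : 1 ≤ n ℕ.∸ a ℕ.∸ b ℕ.∸ c ℕ.∸ d
  n∈ = totalDegree⁺ n a b c d ℕ.≤-refl

  u g r : PowerSeries
  u = 1# - f
  g = sum {n} (λ k → u ^ toℕ k)
  r = f ⁻¹ - g

  u∈ : ∀ k → Deg.F k (u ^ k)
  u∈ = ^∈Deg (∈Deg1 (≡.cong (λ z → 1ℤ ℤ.+ ℤ.- z) f≡1))

  u^n∈ : Deg.F n (u ^ n)
  u^n∈ = u∈ n

  f*r∈ : Deg.F n (f * r)
  f*r∈ = Deg.F-* {0} {n} {f} {r}
    (λ a b c d p → contradiction (totalDegree⁻ 0 a b c d p) λ ()) (∑∞-truncate u∈ n)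

  split : f * f ⁻¹ ≈ f * g + f * r
  split = begin
    f * f ⁻¹       ≈⟨ PS.*-congˡ {f} (PS.trans (PS.+-comm g r) (PSI.[x-y]+y≈x (f ⁻¹) g)) ⟨
    f * (g + r)    ≈⟨ PS.distribˡ f g r ⟩
    f * g + f * r  ∎
    where open PS-Reasoning

  main : f * g + u ^ n ≈ 1#
  main = PSI.geometric-inverse f n

-- Series without y₁, y₂, y₃

ι : (ℕ → ℤ) → PowerSeries
ι x = S₁.const (S₂.const (S₃.const x))

IsConstant : PowerSeries → Set
IsConstant f = ∃ λ x → f ≈ ι x

ι-* : ∀ x y → ι (x R₀.⊛ y) ≈ ι x * ι y
ι-* x y = PS.trans
  (R₁.const-cong λ n → ≡₃.trans (R₂.const-cong (R₃.const-* x y) n) (R₂.const-* (S₃.const x) (S₃.const y) n))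
  (R₁.const-* (S₂.const (S₃.const x)) (S₂.const (S₃.const y)))
  where import Algebra.Bundles
        module ≡₃ = Algebra.Bundles.CommutativeRing (bundle {S₃.rawRing⟦X⟧} R₃.isCommutative⟦X⟧)

ι-+ : ∀ x y → ι (x R₀.⊕ y) ≈ ι x + ι y
ι-+ x y zero    zero    zero    d = ≡.refl
ι-+ x y zero    zero    (suc c) d = ≡.refl
ι-+ x y zero    (suc b) c       d = ≡.refl
ι-+ x y (suc a) b       c       d = ≡.refl

ι-neg : ∀ x → ι (R₀.Raw.- x) ≈ - ι x
ι-neg x zero    zero    zero    d = ≡.refl
ι-neg x zero    zero    (suc c) d = ≡.refl
ι-neg x zero    (suc b) c       d = ≡.refl
ι-neg x (suc a) b       c       d = ≡.refl

1#-constant : IsConstant 1#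
1#-constant = R₀.Raw.1# , eq
  where
  eq : 1# ≈ ι R₀.Raw.1#
  eq zero    zero    zero    d = ≡.refl
  eq zero    zero    (suc c) d = ≡.refl
  eq zero    (suc b) c       d = ≡.refl
  eq (suc a) b       c       d = ≡.refl

q-constant : IsConstant q
q-constant = Sq.X , PS.refl

*-constant : ∀ {f g} → IsConstant f → IsConstant g → IsConstant (f * g)
*-constant (x , p) (y , p′) = x R₀.⊛ y , PS.trans (PS.*-cong p p′) (PS.sym (ι-* x y))

+-constant : ∀ {f g} → IsConstant f → IsConstant g → IsConstant (f + g)
+-constant (x , p) (y , p′) = x R₀.⊕ y , PS.trans (PS.+-cong p p′) (PS.sym (ι-+ x y))

neg-constant : ∀ {f} → IsConstant f → IsConstant (- f)
neg-constant (x , p) = R₀.Raw.- x , PS.trans (PS.-‿cong p) (PS.sym (ι-neg x))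

^-constant : ∀ {f} → IsConstant f → ∀ n → IsConstant (f ^ n)
^-constant p zero    = 1#-constant
^-constant p (suc n) = *-constant p (^-constant p n)

pochhammer-constant : ∀ {f g} → IsConstant f → IsConstant g → ∀ n → IsConstant (⟨ f ⨾ g ⟩ n)
pochhammer-constant p p′ zero    = 1#-constant
pochhammer-constant p p′ (suc n) = *-constant (pochhammer-constant p p′ n)
  (+-constant 1#-constant (neg-constant (*-constant p (^-constant p′ n))))

∑∞-constant : ∀ {F} → (∀ k → IsConstant (F k)) → IsConstant (∑∞ F)
∑∞-constant {F} p = ∑∞ F 0 0 0 , eq
  where
  vanish : ∀ a b c d → (∀ x → ι x a b c d ≡ 0ℤ) → ∑∞ F a b c d ≡ 0ℤ
  vanish a b c d ι≡0 = ≡.trans (coeff-∑∞ F a b c d) (sumTo-zero (suc (a ℕ.+ b ℕ.+ c ℕ.+ d))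
    (λ k → ≡.trans (proj₂ (p k) a b c d) (ι≡0 (proj₁ (p k)))))

  eq : ∑∞ F ≈ ι (∑∞ F 0 0 0)
  eq zero    zero    zero    d = ≡.refl
  eq zero    zero    (suc c) d = vanish zero zero (suc c) d λ _ → ≡.refl
  eq zero    (suc b) c       d = vanish zero (suc b) c d λ _ → ≡.refl
  eq (suc a) b       c       d = vanish (suc a) b c d λ _ → ≡.refl

⁻¹-constant : ∀ {f} → IsConstant f → IsConstant (f ⁻¹)
⁻¹-constant p = ∑∞-constant (^-constant (+-constant 1#-constant (neg-constant p)))

y : Color → PowerSeries
y R = y₁
y G = y₂
y B = y₃

-- Multiplication by y c acts on coefficients as previous 0 c.
previous : ∀ {A : Set} → A → Color → (ℕ → ℕ → ℕ → A) → ℕ → ℕ → ℕ → A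
previous z R r zero    b       c       = z
previous z R r (suc a) b       c       = r a b c
previous z G r a       zero    c       = z
previous z G r a       (suc b) c       = r a b c
previous z B r a       b       zero    = z
previous z B r a       b       (suc c) = r a b c

y-* : ∀ c f → y c * f ≈ previous (λ _ → 0ℤ) c f
y-* R f zero    b       c       d = R₁.X-⊛-zero f b c d
y-* R f (suc a) b       c       d = R₁.X-⊛-suc f a b c d
y-* G f a       zero    c       d = ≡.trans (R₁.const-⊛ S₂.X f a 0 c d) (R₂.X-⊛-zero (f a) c d)
y-* G f a       (suc b) c       d = ≡.trans (R₁.const-⊛ S₂.X f a (suc b) c d) (R₂.X-⊛-suc (f a) b c d)
y-* B f a       b       zero    d = ≡.trans (R₁.const-⊛ (S₂.const S₃.X) f a b 0 d)
  (≡.trans (R₂.const-⊛ S₃.X (f a) b 0 d) (R₃.X-⊛-zero (f a b) d))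
y-* B f a       b       (suc c) d = ≡.trans (R₁.const-⊛ (S₂.const S₃.X) f a b (suc c) d)
  (≡.trans (R₂.const-⊛ S₃.X (f a) b (suc c) d) (R₃.X-⊛-suc (f a b) c d))

q-*-row : ∀ f a b c → (q * f) a b c R₀.≈ˢ (Sq.X R₀.⊛ f a b c)
q-*-row f a b c d = ≡.trans (R₁.const-⊛ (S₂.const (S₃.const Sq.X)) f a b c d)
  (≡.trans (R₂.const-⊛ (S₃.const Sq.X) (f a) b c d) (R₃.const-⊛ Sq.X (f a b) c d))

q-*-zero : ∀ f a b c → (q * f) a b c 0 ≡ 0ℤ
q-*-zero f a b c = ≡.trans (q-*-row f a b c 0) (R₀.X-⊛-zero (f a b c))

q-*-suc : ∀ f a b c d → (q * f) a b c (suc d) ≡ f a b c d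
q-*-suc f a b c d = ≡.trans (q-*-row f a b c (suc d)) (R₀.X-⊛-suc (f a b c) d)

-- Monomials in y₁, y₂, y₃ and triple sums of them

monomial : ℕ → ℕ → ℕ → (ℕ → ℤ) → PowerSeries
monomial i j k x =
  R₁.X R₁.^ˢ i R₁.⊛ S₁.const (R₂.X R₂.^ˢ j R₂.⊛ S₂.const (R₃.X R₃.^ˢ k R₃.⊛ S₃.const x))

-- The powers of y₂ and y₃ are constants for the outer layers of the iterated ring, so their
-- products move inside `const`. Each exponent can then be read off in its own layer.
monomial-≈ : ∀ i j k x → y₁ ^ i * (y₂ ^ j * (y₃ ^ k * ι x)) ≈ monomial i j k x
monomial-≈ i j k x = PS.*-congˡ {y₁ ^ i} {y₂ ^ j * (y₃ ^ k * ι x)}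
    {S₁.const (X₂ʲ R₂.⊛ S₂.const (X₃ᵏ R₃.⊛ S₃.const x))} (begin
  y₂ ^ j * (y₃ ^ k * ι x)
    ≈⟨ PS.*-congʳ {y₃ ^ k * ι x} {y₂ ^ j} {S₁.const X₂ʲ} (PS.sym {S₁.const X₂ʲ} {y₂ ^ j} (R₁.const-^ S₂.X j)) ⟩
  S₁.const X₂ʲ * (y₃ ^ k * ι x)
    ≈⟨ PS.*-congˡ {S₁.const X₂ʲ} {y₃ ^ k * ι x} {S₁.const (S₂.const (X₃ᵏ R₃.⊛ S₃.const x))} inner ⟩
  S₁.const X₂ʲ * S₁.const (S₂.const (X₃ᵏ R₃.⊛ S₃.const x))
    ≈⟨ R₁.const-* X₂ʲ (S₂.const (X₃ᵏ R₃.⊛ S₃.const x)) ⟨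
  S₁.const (X₂ʲ R₂.⊛ S₂.const (X₃ᵏ R₃.⊛ S₃.const x)) ∎)
  where
  open PS-Reasoning

  X₂ʲ : ℕ → ℕ → ℕ → ℤ
  X₂ʲ = R₂.X R₂.^ˢ j

  X₃ᵏ : ℕ → ℕ → ℤ
  X₃ᵏ = R₃.X R₃.^ˢ k

  y₃ᵏ : S₁.const (S₂.const X₃ᵏ) ≈ y₃ ^ k
  y₃ᵏ = begin
    S₁.const (S₂.const X₃ᵏ)          ≈⟨ R₁.const-cong {S₂.const X₃ᵏ} {S₂.const S₃.X R₂.^ˢ k} (R₂.const-^ S₃.X k) ⟩
    S₁.const (S₂.const S₃.X R₂.^ˢ k) ≈⟨ R₁.const-^ (S₂.const S₃.X) k ⟩
    y₃ ^ k                           ∎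

  inner : y₃ ^ k * ι x ≈ S₁.const (S₂.const (X₃ᵏ R₃.⊛ S₃.const x))
  inner = begin
    y₃ ^ k * ι x
      ≈⟨ PS.*-congʳ {ι x} {S₁.const (S₂.const X₃ᵏ)} {y₃ ^ k} y₃ᵏ ⟨
    S₁.const (S₂.const X₃ᵏ) * ι x
      ≈⟨ R₁.const-* (S₂.const X₃ᵏ) (S₂.const (S₃.const x)) ⟨
    S₁.const (S₂.const X₃ᵏ R₂.⊛ S₂.const (S₃.const x))
      ≈⟨ R₁.const-cong {S₂.const (X₃ᵏ R₃.⊛ S₃.const x)} (R₂.const-* X₃ᵏ (S₃.const x)) ⟨
    S₁.const (S₂.const (X₃ᵏ R₃.⊛ S₃.const x)) ∎

monomial-coeff : ∀ a b c d x → monomial a b c x a b c d ≡ x d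
monomial-coeff a b c d x = ≡.trans (R₁.X^-⊛-const a _ b c d)
  (≡.trans (R₂.X^-⊛-const b _ c d) (R₃.X^-⊛-const c x d))

monomial-≢₁ : ∀ {i a} j k b c d x → i ≢ a → monomial i j k x a b c d ≡ 0ℤ
monomial-≢₁ j k b c d x i≢a = R₁.X^-⊛-const-≢ _ (≡.≢-sym i≢a) b c d

monomial-≢₂ : ∀ {j b} a k c d x → j ≢ b → monomial a j k x a b c d ≡ 0ℤ
monomial-≢₂ a k c d x j≢b =
  ≡.trans (R₁.X^-⊛-const a _ _ c d) (R₂.X^-⊛-const-≢ _ (≡.≢-sym j≢b) c d)

monomial-≢₃ : ∀ {k c} a b d x → k ≢ c → monomial a b k x a b c d ≡ 0ℤ
monomial-≢₃ a b d x k≢c = ≡.trans (R₁.X^-⊛-const a _ b _ d)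
  (≡.trans (R₂.X^-⊛-const b _ _ d) (R₃.X^-⊛-const-≢ x (≡.≢-sym k≢c) d))

∑³ : (ℕ → ℕ → ℕ → PowerSeries) → PowerSeries
∑³ f = ∑∞ λ n₁ → ∑∞ λ n₂ → ∑∞ λ n₃ → f n₁ n₂ n₃

-- All three nested sums are read at the same coefficient, so they share the bound a + b + c + d,
-- which lies above each of a, b, c. Only the summand with these indices reaches that coefficient.
∑³-monomials : ∀ (f : ℕ → ℕ → ℕ → PowerSeries) {x : ℕ → ℕ → ℕ → ℕ → ℤ} →
               (∀ i j k → f i j k ≈ monomial i j k (x i j k)) →
               ∀ a b c d → ∑³ f a b c d ≡ x a b c d
∑³-monomials f {x} f≈ a b c d = begin
  ∑³ f a b c d
    ≡⟨ coeff-∑∞ (λ i → ∑∞ λ j → ∑∞ λ k → f i j k) a b c d ⟩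
  sumTo n (λ i → (∑∞ λ j → ∑∞ λ k → f i j k) a b c d)
    ≡⟨ sumTo-single {h = λ i → (∑∞ λ j → ∑∞ λ k → f i j k) a b c d} a<n (λ i i≢a → ≡.trans
         (coeff-∑∞ (λ j → ∑∞ λ k → f i j k) a b c d)
         (sumTo-zero n λ j → ≡.trans (coeff-∑∞ (λ k → f i j k) a b c d)
           (sumTo-zero n λ k → ≡.trans (f≈ i j k a b c d) (monomial-≢₁ j k b c d (x i j k) i≢a)))) ⟩
  (∑∞ λ j → ∑∞ λ k → f a j k) a b c d
    ≡⟨ coeff-∑∞ (λ j → ∑∞ λ k → f a j k) a b c d ⟩
  sumTo n (λ j → (∑∞ λ k → f a j k) a b c d)
    ≡⟨ sumTo-single {h = λ j → (∑∞ λ k → f a j k) a b c d} b<n (λ j j≢b → ≡.trans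
         (coeff-∑∞ (λ k → f a j k) a b c d)
         (sumTo-zero n λ k → ≡.trans (f≈ a j k a b c d) (monomial-≢₂ a k c d (x a j k) j≢b))) ⟩
  (∑∞ λ k → f a b k) a b c d
    ≡⟨ coeff-∑∞ (λ k → f a b k) a b c d ⟩
  sumTo n (λ k → f a b k a b c d)
    ≡⟨ sumTo-single {h = λ k → f a b k a b c d} c<n (λ k k≢c →
         ≡.trans (f≈ a b k a b c d) (monomial-≢₃ a b d (x a b k) k≢c)) ⟩
  f a b c a b c d
    ≡⟨ f≈ a b c a b c d ⟩
  monomial a b c (x a b c) a b c d
    ≡⟨ monomial-coeff a b c d (x a b c) ⟩
  x a b c d ∎
  where
  open ≡.≡-Reasoning

  n : ℕ
  n = suc (a ℕ.+ b ℕ.+ c ℕ.+ d)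

  c<n : c < n
  c<n = s≤s (ℕ.≤-trans (ℕ.m≤n+m c (a ℕ.+ b)) (ℕ.m≤m+n (a ℕ.+ b ℕ.+ c) d))

  a+b<n : a ℕ.+ b < n
  a+b<n = s≤s (ℕ.≤-trans (ℕ.m≤m+n (a ℕ.+ b) c) (ℕ.m≤m+n (a ℕ.+ b ℕ.+ c) d))

  a<n : a < n
  a<n = ℕ.≤-<-trans (ℕ.m≤m+n a b) a+b<n

  b<n : b < n
  b<n = ℕ.≤-<-trans (ℕ.m≤n+m b a) a+b<n

-- An opaque copy of the ring of power series

infix  4 _≐_
infixl 6 _⊞_
infixl 7 _⊠_
infix  8 ⊟_
infixr 8 _⋆_

-- Opaque copies of the operations, since conversion checking would otherwise unfold
-- products of series into nested convolution sums.
opaque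
  _≐_ : PowerSeries → PowerSeries → Set
  f ≐ g = f ≈ g

  _⊞_ _⊠_ : PowerSeries → PowerSeries → PowerSeries
  f ⊞ g = f + g
  f ⊠ g = f * g

  ⊟_ : PowerSeries → PowerSeries
  ⊟ f = - f

  𝟘 𝟙 : PowerSeries
  𝟘 = 0#
  𝟙 = 1#

opaqueRing : RawRing 0ℓ 0ℓ
opaqueRing = record
  { Carrier = PowerSeries ; _≈_ = _≐_ ; _+_ = _⊞_ ; _*_ = _⊠_ ; -_ = ⊟_ ; 0# = 𝟘 ; 1# = 𝟙 }

opaque
  unfolding _≐_

  isCommutative : IsCommutative opaqueRing
  isCommutative = R₁.isCommutative⟦X⟧

  ≈⇒≐ : ∀ {f g} → f ≈ g → f ≐ g
  ≈⇒≐ p = p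

  ≐⇒≈ : ∀ {f g} → f ≐ g → f ≈ g
  ≐⇒≈ p = p

  +≡⊞ : ∀ f g → f + g ≡ f ⊞ g
  +≡⊞ f g = ≡.refl

  *≡⊠ : ∀ f g → f * g ≡ f ⊠ g
  *≡⊠ f g = ≡.refl

  -≡⊟ : ∀ f → - f ≡ ⊟ f
  -≡⊟ f = ≡.refl

  0≡𝟘 : 0# ≡ 𝟘
  0≡𝟘 = ≡.refl

  1≡𝟙 : 1# ≡ 𝟙
  1≡𝟙 = ≡.refl

module O = CommutativeRing (bundle {opaqueRing} isCommutative)
module I = RingIdentities opaqueRing isCommutative
module ≐-Reasoning = SetoidReasoning O.setoid

_⋆_ : PowerSeries → ℕ → PowerSeries
_⋆_ = RawSemiringDefs._^_ (RawRing.rawSemiring opaqueRing)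

*≡⊠-cong : ∀ f g {f′ g′} → f ≡ f′ → g ≡ g′ → f * g ≡ f′ ⊠ g′
*≡⊠-cong f g ≡.refl ≡.refl = *≡⊠ f g

^≡⋆ : ∀ f n → f ^ n ≡ f ⋆ n
^≡⋆ f zero    = 1≡𝟙
^≡⋆ f (suc n) = *≡⊠-cong f (f ^ n) ≡.refl (^≡⋆ f n)

1-≡ : ∀ f {g} → f ≡ g → 1# - f ≡ 𝟙 ⊞ ⊟ g
1-≡ f ≡.refl = ≡.trans (+≡⊞ 1# (- f)) (≡.cong₂ _⊞_ 1≡𝟙 (-≡⊟ f))

coeff-⊞ : ∀ f g a b c d → (f ⊞ g) a b c d ≡ f a b c d ℤ.+ g a b c d
coeff-⊞ f g a b c d = ≡.cong (λ h → h a b c d) (≡.sym (+≡⊞ f g))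

coeff-⊟ : ∀ f a b c d → (⊟ f) a b c d ≡ ℤ.- f a b c d
coeff-⊟ f a b c d = ≡.cong (λ h → h a b c d) (≡.sym (-≡⊟ f))

coeff-𝟘 : ∀ a b c d → 𝟘 a b c d ≡ 0ℤ
coeff-𝟘 a b c d = ≡.cong (λ h → h a b c d) (≡.sym 0≡𝟘)

coeff-𝟙 : ∀ a b c d → 𝟙 a b c d ≡ 1# a b c d
coeff-𝟙 a b c d = ≡.cong (λ h → h a b c d) (≡.sym 1≡𝟙)

y-⊠ : ∀ c f → y c ⊠ f ≈ previous (λ _ → 0ℤ) c f
y-⊠ c f = ≡.subst (λ h → h ≈ previous (λ _ → 0ℤ) c f) (*≡⊠ (y c) f) (y-* c f)

q-⊠-zero : ∀ f a b c → (q ⊠ f) a b c 0 ≡ 0ℤ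
q-⊠-zero f a b c = ≡.subst (λ h → h a b c 0 ≡ 0ℤ) (*≡⊠ q f) (q-*-zero f a b c)

q-⊠-suc : ∀ f a b c d → (q ⊠ f) a b c (suc d) ≡ f a b c d
q-⊠-suc f a b c d =
  ≡.subst (λ h → h a b c (suc d) ≡ f a b c d) (*≡⊠ q f) (q-*-suc f a b c d)

constantTerm-⊠ : ∀ f g → constantTerm (f ⊠ g) ≡ constantTerm f ℤ.* constantTerm g
constantTerm-⊠ f g =
  ≡.subst (λ h → constantTerm h ≡ constantTerm f ℤ.* constantTerm g) (*≡⊠ f g) (constantTerm-* f g)

⊠-inverseʳ : ∀ {f} → constantTerm f ≡ 1ℤ → f ⊠ f ⁻¹ ≐ 𝟙
⊠-inverseʳ {f} p = ≡.subst₂ _≐_ (*≡⊠ f (f ⁻¹)) 1≡𝟙 (≈⇒≐ {f * f ⁻¹} {1#} (⁻¹-inverseʳ {f} p))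

⊠-constant : ∀ {f g} → IsConstant f → IsConstant g → IsConstant (f ⊠ g)
⊠-constant {f} {g} p p′ = ≡.subst IsConstant (*≡⊠ f g) (*-constant p p′)

⋆-constant : ∀ {f} → IsConstant f → ∀ n → IsConstant (f ⋆ n)
⋆-constant {f} p n = ≡.subst IsConstant (^≡⋆ f n) (^-constant p n)

-- The series Σ r a b c y₁ᵃ y₂ᵇ y₃ᶜ, for series r a b c in q alone.
rows : (ℕ → ℕ → ℕ → PowerSeries) → PowerSeries
rows r a b c = r a b c 0 0 0

rows-cong : ∀ {r r′} → (∀ a b c → r a b c ≐ r′ a b c) → rows r ≐ rows r′
rows-cong p = ≈⇒≐ λ a b c → ≐⇒≈ (p a b c) 0 0 0

rows-⊞ : ∀ r r′ → rows (λ a b c → r a b c ⊞ r′ a b c) ≐ rows r ⊞ rows r′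
rows-⊞ r r′ = ≈⇒≐ λ a b c d →
  ≡.trans (coeff-⊞ (r a b c) (r′ a b c) 0 0 0 d) (≡.sym (coeff-⊞ (rows r) (rows r′) a b c d))

rows-𝟘 : rows (λ _ _ _ → 𝟘) ≐ 𝟘
rows-𝟘 = ≈⇒≐ λ a b c d → ≡.trans (coeff-𝟘 0 0 0 d) (≡.sym (coeff-𝟘 a b c d))

y-⊠-rows : ∀ c r → y c ⊠ rows r ≐ rows (previous 𝟘 c r)
y-⊠-rows c r = ≈⇒≐ λ i j k d → ≡.trans (y-⊠ c (rows r) i j k d) (lemma c i j k d)
  where
  lemma : ∀ c i j k d → previous (λ _ → 0ℤ) c (rows r) i j k d ≡ rows (previous 𝟘 c r) i j k d
  lemma R zero    j       k       d = ≡.sym (coeff-𝟘 0 0 0 d)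
  lemma R (suc i) j       k       d = ≡.refl
  lemma G i       zero    k       d = ≡.sym (coeff-𝟘 0 0 0 d)
  lemma G i       (suc j) k       d = ≡.refl
  lemma B i       j       zero    d = ≡.sym (coeff-𝟘 0 0 0 d)
  lemma B i       j       (suc k) d = ≡.refl

q-⊠-rows : ∀ r → q ⊠ rows r ≐ rows (λ a b c → q ⊠ r a b c)
q-⊠-rows r = ≈⇒≐ lemma
  where
  lemma : q ⊠ rows r ≈ rows (λ a b c → q ⊠ r a b c)
  lemma a b c zero    = ≡.trans (q-⊠-zero (rows r) a b c) (≡.sym (q-⊠-zero (r a b c) 0 0 0))
  lemma a b c (suc d) = ≡.trans (q-⊠-suc (rows r) a b c d) (≡.sym (q-⊠-suc (r a b c) 0 0 0 d))

q⋆-⊠-rows : ∀ n r → q ⋆ n ⊠ rows r ≐ rows (λ a b c → q ⋆ n ⊠ r a b c)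
q⋆-⊠-rows zero    r = O.trans (O.*-identityˡ (rows r))
  (rows-cong λ a b c → O.sym (O.*-identityˡ (r a b c)))
q⋆-⊠-rows (suc n) r = begin
  q ⊠ q ⋆ n ⊠ rows r                        ≈⟨ O.*-assoc q (q ⋆ n) (rows r) ⟩
  q ⊠ (q ⋆ n ⊠ rows r)                      ≈⟨ O.*-congˡ (q⋆-⊠-rows n r) ⟩
  q ⊠ rows (λ a b c → q ⋆ n ⊠ r a b c)      ≈⟨ q-⊠-rows (λ a b c → q ⋆ n ⊠ r a b c) ⟩
  rows (λ a b c → q ⊠ (q ⋆ n ⊠ r a b c))    ≈⟨ rows-cong (λ a b c → O.*-assoc q (q ⋆ n) (r a b c)) ⟨
  rows (λ a b c → q ⊠ q ⋆ n ⊠ r a b c)      ∎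
  where open ≐-Reasoning

-- The summands of T

D poch : ℕ → PowerSeries
D = ⟨ q ^ 2 ⨾ q ^ 2 ⟩_
poch = ⟨ - q ⨾ q ⟩_

-- These are verbatim parts of the definition of T, split off one at a time: any
-- other phrasing makes the conversion checker unfold nested convolution sums.
summand quotient numerator powers powers₁₂ :
  PowerSeries → PowerSeries → PowerSeries → ℕ → ℕ → ℕ → PowerSeries
summand Y₁ Y₂ Y₃ n₁ n₂ n₃ =
  q ^ exponent n₁ n₂ n₃ *
  ( (Y₁ ^ n₁ * Y₂ ^ n₂ * Y₃ ^ n₃ * ⟨ - q ⨾ q ⟩ (n₁ ℕ.+ n₂ ℕ.+ n₃))
  / (⟨ q ^ 2 ⨾ q ^ 2 ⟩ n₁ * ⟨ q ^ 2 ⨾ q ^ 2 ⟩ n₂ * ⟨ q ^ 2 ⨾ q ^ 2 ⟩ n₃) )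
quotient Y₁ Y₂ Y₃ n₁ n₂ n₃ =
    (Y₁ ^ n₁ * Y₂ ^ n₂ * Y₃ ^ n₃ * ⟨ - q ⨾ q ⟩ (n₁ ℕ.+ n₂ ℕ.+ n₃))
  / (⟨ q ^ 2 ⨾ q ^ 2 ⟩ n₁ * ⟨ q ^ 2 ⨾ q ^ 2 ⟩ n₂ * ⟨ q ^ 2 ⨾ q ^ 2 ⟩ n₃)
numerator Y₁ Y₂ Y₃ n₁ n₂ n₃ = Y₁ ^ n₁ * Y₂ ^ n₂ * Y₃ ^ n₃ * ⟨ - q ⨾ q ⟩ (n₁ ℕ.+ n₂ ℕ.+ n₃)
powers Y₁ Y₂ Y₃ n₁ n₂ n₃ = Y₁ ^ n₁ * Y₂ ^ n₂ * Y₃ ^ n₃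
powers₁₂ Y₁ Y₂ Y₃ n₁ n₂ n₃ = Y₁ ^ n₁ * Y₂ ^ n₂

inverse denominator denominator₁₂ : ℕ → ℕ → ℕ → PowerSeries
inverse n₁ n₂ n₃ = (⟨ q ^ 2 ⨾ q ^ 2 ⟩ n₁ * ⟨ q ^ 2 ⨾ q ^ 2 ⟩ n₂ * ⟨ q ^ 2 ⨾ q ^ 2 ⟩ n₃) ⁻¹
denominator n₁ n₂ n₃ = ⟨ q ^ 2 ⨾ q ^ 2 ⟩ n₁ * ⟨ q ^ 2 ⨾ q ^ 2 ⟩ n₂ * ⟨ q ^ 2 ⨾ q ^ 2 ⟩ n₃
denominator₁₂ n₁ n₂ n₃ = ⟨ q ^ 2 ⨾ q ^ 2 ⟩ n₁ * ⟨ q ^ 2 ⨾ q ^ 2 ⟩ n₂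

T-∑³ : ∀ Y₁ Y₂ Y₃ a b c d → T Y₁ Y₂ Y₃ a b c d ≡ ∑³ (summand Y₁ Y₂ Y₃) a b c d
T-∑³ Y₁ Y₂ Y₃ a b c d = ≡.refl

summand-split : ∀ Y₁ Y₂ Y₃ i j k a b c d →
  summand Y₁ Y₂ Y₃ i j k a b c d ≡ (q ^ exponent i j k * quotient Y₁ Y₂ Y₃ i j k) a b c d
summand-split Y₁ Y₂ Y₃ i j k a b c d = ≡.refl

quotient-split : ∀ Y₁ Y₂ Y₃ i j k a b c d →
  quotient Y₁ Y₂ Y₃ i j k a b c d ≡ (numerator Y₁ Y₂ Y₃ i j k * inverse i j k) a b c d
quotient-split Y₁ Y₂ Y₃ i j k a b c d = ≡.refl

numerator-split : ∀ Y₁ Y₂ Y₃ i j k a b c d → numerator Y₁ Y₂ Y₃ i j k a b c d ≡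
  (powers Y₁ Y₂ Y₃ i j k * ⟨ - q ⨾ q ⟩ (i ℕ.+ j ℕ.+ k)) a b c d
numerator-split Y₁ Y₂ Y₃ i j k a b c d = ≡.refl

powers-split : ∀ Y₁ Y₂ Y₃ i j k a b c d →
  powers Y₁ Y₂ Y₃ i j k a b c d ≡ (powers₁₂ Y₁ Y₂ Y₃ i j k * Y₃ ^ k) a b c d
powers-split Y₁ Y₂ Y₃ i j k a b c d = ≡.refl

powers₁₂-split : ∀ Y₁ Y₂ Y₃ i j k a b c d →
  powers₁₂ Y₁ Y₂ Y₃ i j k a b c d ≡ (Y₁ ^ i * Y₂ ^ j) a b c d
powers₁₂-split Y₁ Y₂ Y₃ i j k a b c d = ≡.refl

inverse-split : ∀ i j k a b c d → inverse i j k a b c d ≡ (denominator i j k ⁻¹) a b c d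
inverse-split i j k a b c d = ≡.refl

denominator-split : ∀ i j k a b c d →
  denominator i j k a b c d ≡ (denominator₁₂ i j k * ⟨ q ^ 2 ⨾ q ^ 2 ⟩ k) a b c d
denominator-split i j k a b c d = ≡.refl

denominator₁₂-split : ∀ i j k a b c d →
  denominator₁₂ i j k a b c d ≡ (⟨ q ^ 2 ⨾ q ^ 2 ⟩ i * ⟨ q ^ 2 ⨾ q ^ 2 ⟩ j) a b c d
denominator₁₂-split i j k a b c d = ≡.refl

split-⊠ : ∀ {f} g h {g′ h′} → f ≈ g * h → g ≐ g′ → h ≐ h′ → f ≐ g′ ⊠ h′
split-⊠ {f} g h p g≐ h≐ = O.trans (≡.subst (f ≐_) (*≡⊠ g h) (≈⇒≐ p)) (O.*-cong g≐ h≐)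

^≐⋆ : ∀ f n → f ^ n ≐ f ⋆ n
^≐⋆ f n = O.reflexive (^≡⋆ f n)

summand-≐ : ∀ Y₁ Y₂ Y₃ i j k → summand Y₁ Y₂ Y₃ i j k ≐
  q ⋆ exponent i j k ⊠ (Y₁ ⋆ i ⊠ Y₂ ⋆ j ⊠ Y₃ ⋆ k ⊠ poch (i ℕ.+ j ℕ.+ k) ⊠ inverse i j k)
summand-≐ Y₁ Y₂ Y₃ i j k =
  split-⊠ (q ^ exponent i j k) (quotient Y₁ Y₂ Y₃ i j k) (summand-split Y₁ Y₂ Y₃ i j k)
    (^≐⋆ q (exponent i j k))
  (split-⊠ (numerator Y₁ Y₂ Y₃ i j k) (inverse i j k) (quotient-split Y₁ Y₂ Y₃ i j k)
  (split-⊠ (powers Y₁ Y₂ Y₃ i j k) (poch (i ℕ.+ j ℕ.+ k)) (numerator-split Y₁ Y₂ Y₃ i j k)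
  (split-⊠ (powers₁₂ Y₁ Y₂ Y₃ i j k) (Y₃ ^ k) (powers-split Y₁ Y₂ Y₃ i j k)
  (split-⊠ (Y₁ ^ i) (Y₂ ^ j) (powers₁₂-split Y₁ Y₂ Y₃ i j k)
    (^≐⋆ Y₁ i) (^≐⋆ Y₂ j)) (^≐⋆ Y₃ k)) O.refl) O.refl)

denominator-≐ : ∀ i j k → denominator i j k ≐ D i ⊠ D j ⊠ D k
denominator-≐ i j k = split-⊠ (denominator₁₂ i j k) (D k) (denominator-split i j k)
  (split-⊠ (D i) (D j) (denominator₁₂-split i j k) O.refl O.refl) O.refl

IsConstant-resp : ∀ {f g} → f ≐ g → IsConstant g → IsConstant f
IsConstant-resp {f} p (x , p′) = x , ≐⇒≈ (O.trans p (≈⇒≐ p′))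

D-constant : ∀ n → IsConstant (D n)
D-constant = pochhammer-constant {q ^ 2} {q ^ 2} (^-constant {q} q-constant 2) (^-constant {q} q-constant 2)

poch-constant : ∀ n → IsConstant (poch n)
poch-constant = pochhammer-constant { - q } {q} (neg-constant {q} q-constant) q-constant

inverse-constant : ∀ i j k → IsConstant (inverse i j k)
inverse-constant i j k = IsConstant-resp {inverse i j k} {denominator i j k ⁻¹} (≈⇒≐ (inverse-split i j k))
  (⁻¹-constant {denominator i j k} (IsConstant-resp (denominator-≐ i j k)
    (⊠-constant {D i ⊠ D j} {D k} (⊠-constant {D i} {D j} (D-constant i) (D-constant j)) (D-constant k))))

t : ℕ → ℕ → ℕ → PowerSeries
t a b c = q ⋆ exponent a b c ⊠ (poch (a ℕ.+ b ℕ.+ c) ⊠ inverse a b c)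

t-constant : ∀ a b c → IsConstant (t a b c)
t-constant a b c =
  ⊠-constant {q ⋆ exponent a b c} {poch (a ℕ.+ b ℕ.+ c) ⊠ inverse a b c}
    (⋆-constant {q} q-constant (exponent a b c))
    (⊠-constant {poch (a ℕ.+ b ℕ.+ c)} {inverse a b c}
      (poch-constant (a ℕ.+ b ℕ.+ c)) (inverse-constant a b c))

monomial-≐ : ∀ i j k x → y₁ ⋆ i ⊠ (y₂ ⋆ j ⊠ (y₃ ⋆ k ⊠ ι x)) ≐ monomial i j k x
monomial-≐ i j k x = ≡.subst (_≐ monomial i j k x)
  (*≡⊠-cong (y₁ ^ i) (y₂ ^ j * (y₃ ^ k * ι x)) (^≡⋆ y₁ i)
    (*≡⊠-cong (y₂ ^ j) (y₃ ^ k * ι x) (^≡⋆ y₂ j)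
      (*≡⊠-cong (y₃ ^ k) (ι x) (^≡⋆ y₃ k) ≡.refl)))
  (≈⇒≐ (monomial-≈ i j k x))

T-coefficients : ∀ Y₁ Y₂ Y₃ {x} →
  (∀ i j k → summand Y₁ Y₂ Y₃ i j k ≐ monomial i j k (x i j k)) →
  ∀ a b c d → T Y₁ Y₂ Y₃ a b c d ≡ x a b c d
T-coefficients Y₁ Y₂ Y₃ {x} p a b c d = ≡.trans (T-∑³ Y₁ Y₂ Y₃ a b c d)
  (∑³-monomials (summand Y₁ Y₂ Y₃) {x}
    (λ i j k → ≐⇒≈ {summand Y₁ Y₂ Y₃ i j k} {monomial i j k (x i j k)} (p i j k)) a b c d)

summand-monomial : ∀ {Y₁ Y₂ Y₃} u v w i j k {x} → Y₁ ≡ y₁ ⊠ u → Y₂ ≡ y₂ ⊠ v → Y₃ ≡ y₃ ⊠ w →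
  (u ⋆ i ⊠ v ⋆ j ⊠ w ⋆ k) ⊠ t i j k ≐ ι x → summand Y₁ Y₂ Y₃ i j k ≐ monomial i j k x
summand-monomial {Y₁} {Y₂} {Y₃} u v w i j k {x} ≡.refl ≡.refl ≡.refl p = begin
  summand Y₁ Y₂ Y₃ i j k
    ≈⟨ summand-≐ Y₁ Y₂ Y₃ i j k ⟩
  q ⋆ exponent i j k ⊠ ((y₁ ⊠ u) ⋆ i ⊠ (y₂ ⊠ v) ⋆ j ⊠ (y₃ ⊠ w) ⋆ k ⊠ poch (i ℕ.+ j ℕ.+ k) ⊠ inverse i j k)
    ≈⟨ I.collect (q ⋆ exponent i j k) y₁ u i y₂ v j y₃ w k
         (poch (i ℕ.+ j ℕ.+ k)) (inverse i j k) ⟩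
  y₁ ⋆ i ⊠ (y₂ ⋆ j ⊠ (y₃ ⋆ k ⊠ ((u ⋆ i ⊠ v ⋆ j ⊠ w ⋆ k) ⊠ t i j k)))
    ≈⟨ O.*-congˡ (O.*-congˡ (O.*-congˡ p)) ⟩
  y₁ ⋆ i ⊠ (y₂ ⋆ j ⊠ (y₃ ⋆ k ⊠ ι x))
    ≈⟨ monomial-≐ i j k x ⟩
  monomial i j k x ∎
  where open ≐-Reasoning

-- Since u, v, w and `t` are free of y₁, y₂, y₃, the summand with indices i, j, k is y₁ⁱy₂ʲy₃ᵏ times
-- a series in q. Distinct summands therefore never meet in the same row.
T-rows : ∀ {Y₁ Y₂ Y₃ u v w} → Y₁ ≡ y₁ ⊠ u → Y₂ ≡ y₂ ⊠ v → Y₃ ≡ y₃ ⊠ w →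
         IsConstant u → IsConstant v → IsConstant w →
         T Y₁ Y₂ Y₃ ≐ rows (λ a b c → (u ⋆ a ⊠ v ⋆ b ⊠ w ⋆ c) ⊠ t a b c)
T-rows {Y₁} {Y₂} {Y₃} {u} {v} {w} Y₁≡ Y₂≡ Y₃≡ u-const v-const w-const =
  main (λ i j k → ≈⇒≐ {g i j k} {ι (proj₁ (g-constant i j k))} (proj₂ (g-constant i j k)))
  where
  g : ℕ → ℕ → ℕ → PowerSeries
  g i j k = (u ⋆ i ⊠ v ⋆ j ⊠ w ⋆ k) ⊠ t i j k

  g-constant : ∀ i j k → IsConstant (g i j k)
  g-constant i j k = ⊠-constant {u ⋆ i ⊠ v ⋆ j ⊠ w ⋆ k} {t i j k}
    (⊠-constant {u ⋆ i ⊠ v ⋆ j} {w ⋆ k} (⊠-constant {u ⋆ i} {v ⋆ j}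
      (⋆-constant {u} u-const i) (⋆-constant {v} v-const j)) (⋆-constant {w} w-const k))
    (t-constant i j k)

  main : ∀ {x} → (∀ i j k → g i j k ≐ ι (x i j k)) → T Y₁ Y₂ Y₃ ≐ rows g
  main {x} g≐ = ≈⇒≐ {T Y₁ Y₂ Y₃} {rows g} λ a b c d →
    ≡.trans (T-coefficients Y₁ Y₂ Y₃ {x}
        (λ i j k → summand-monomial u v w i j k {x i j k} Y₁≡ Y₂≡ Y₃≡ (g≐ i j k)) a b c d)
      (≡.sym (≐⇒≈ {g a b c} {ι (x a b c)} (g≐ a b c) 0 0 0 d))

-- The coefficients of T

suc-choose-2 : ∀ n → suc n choose 2 ≡ n ℕ.+ (n choose 2)
suc-choose-2 n = ≡.trans (≡.sym (nCk+nC[k+1]≡[n+1]C[k+1] n 1)) (≡.cong (ℕ._+ (n choose 2)) (nC1≡n n))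

exponent-suc₁ : ∀ a b c → exponent (suc a) b c ≡ exponent a b c ℕ.+ (a ℕ.+ a ℕ.+ a ℕ.+ b ℕ.+ c)
exponent-suc₁ a b c rewrite suc-choose-2 a = solve 6 (λ a b c x y z →
  con 3 :* (a :+ x) :+ y :+ z :+ (con 1 :+ a) :* b :+ b :* c :+ c :* (con 1 :+ a) :=
  con 3 :* x :+ y :+ z :+ a :* b :+ b :* c :+ c :* a :+ (a :+ a :+ a :+ b :+ c))
  ≡.refl a b c (a choose 2) (b choose 2) (c choose 2)
  where open +-*-Solver

exponent-suc₂ : ∀ a b c → exponent a (suc b) c ≡ exponent a b c ℕ.+ (a ℕ.+ b ℕ.+ c)
exponent-suc₂ a b c rewrite suc-choose-2 b = solve 6 (λ a b c x y z →
  con 3 :* x :+ (b :+ y) :+ z :+ a :* (con 1 :+ b) :+ (con 1 :+ b) :* c :+ c :* a :=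
  con 3 :* x :+ y :+ z :+ a :* b :+ b :* c :+ c :* a :+ (a :+ b :+ c))
  ≡.refl a b c (a choose 2) (b choose 2) (c choose 2)
  where open +-*-Solver

exponent-suc₃ : ∀ a b c → exponent a b (suc c) ≡ exponent a b c ℕ.+ (a ℕ.+ b ℕ.+ c)
exponent-suc₃ a b c rewrite suc-choose-2 c = solve 6 (λ a b c x y z →
  con 3 :* x :+ y :+ (c :+ z) :+ a :* b :+ b :* (con 1 :+ c) :+ (con 1 :+ c) :* a :=
  con 3 :* x :+ y :+ z :+ a :* b :+ b :* c :+ c :* a :+ (a :+ b :+ c))
  ≡.refl a b c (a choose 2) (b choose 2) (c choose 2)
  where open +-*-Solver

q⋆-+ : ∀ m n → q ⋆ (m ℕ.+ n) ≐ q ⋆ m ⊠ q ⋆ n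
q⋆-+ = I.^-homo-* q

q⋆-sum : ∀ a b c → q ⋆ (a ℕ.+ b ℕ.+ c) ≐ q ⋆ a ⊠ q ⋆ b ⊠ q ⋆ c
q⋆-sum a b c = O.trans (q⋆-+ (a ℕ.+ b) c) (O.*-congʳ (q⋆-+ a b))

q⋆-exponent-suc : ∀ e e′ m {x} → e′ ≡ e ℕ.+ m → q ⋆ m ≐ x → q ⋆ e′ ≐ q ⋆ e ⊠ x
q⋆-exponent-suc e _ m ≡.refl p = O.trans (q⋆-+ e m) (O.*-congˡ p)

-- Verbatim parts of the definition of the q-Pochhammer symbol, as for T.
pochFactor pochFactor′ DFactor DFactor′ : ℕ → PowerSeries
pochFactor n = 1# - (- q) * q ^ n
pochFactor′ n = (- q) * q ^ n
DFactor n = 1# - q ^ 2 * (q ^ 2) ^ n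
DFactor′ n = q ^ 2 * (q ^ 2) ^ n

poch-split : ∀ n a b c d → poch (suc n) a b c d ≡ (poch n * pochFactor n) a b c d
poch-split n a b c d = ≡.refl

pochFactor-split : ∀ n a b c d → pochFactor n a b c d ≡ (1# - pochFactor′ n) a b c d
pochFactor-split n a b c d = ≡.refl

pochFactor′-split : ∀ n a b c d → pochFactor′ n a b c d ≡ ((- q) * q ^ n) a b c d
pochFactor′-split n a b c d = ≡.refl

D-split : ∀ n a b c d → D (suc n) a b c d ≡ (D n * DFactor n) a b c d
D-split n a b c d = ≡.refl

DFactor-split : ∀ n a b c d → DFactor n a b c d ≡ (1# - DFactor′ n) a b c d
DFactor-split n a b c d = ≡.refl

DFactor′-split : ∀ n a b c d → DFactor′ n a b c d ≡ (q ^ 2 * (q ^ 2) ^ n) a b c d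
DFactor′-split n a b c d = ≡.refl

split-1- : ∀ {f} g {g′} → f ≈ 1# - g → g ≐ g′ → f ≐ 𝟙 ⊞ ⊟ g′
split-1- {f} g p q = O.trans (≡.subst (f ≐_) (1-≡ g ≡.refl) (≈⇒≐ {f} {1# - g} p))
  (O.+-congˡ (O.-‿cong q))

poch-suc : ∀ n → poch (suc n) ≐ poch n ⊠ (𝟙 ⊞ q ⋆ suc n)
poch-suc n = O.trans
  (split-⊠ (poch n) (pochFactor n) (poch-split n) O.refl
    (split-1- (pochFactor′ n) (pochFactor-split n)
      (split-⊠ (- q) (q ^ n) (pochFactor′-split n) (O.reflexive (-≡⊟ q)) (^≐⋆ q n))))
  (O.*-congˡ (I.1--xy≈1+xy q (q ⋆ n)))

D-suc : ∀ n → D (suc n) ≐ D n ⊠ (𝟙 ⊞ ⊟ (q ⋆ suc n ⊠ q ⋆ suc n))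
D-suc n = O.trans
  (split-⊠ (D n) (DFactor n) (D-split n) O.refl
    (split-1- (DFactor′ n) (DFactor-split n)
      (split-⊠ (q ^ 2) ((q ^ 2) ^ n) (DFactor′-split n) (^≐⋆ q 2)
        (O.trans (^≐⋆ (q ^ 2) n) (I.^-congˡ n (^≐⋆ q 2))))))
  (O.*-congˡ (O.+-congˡ (O.-‿cong (I.^2^n≈^n*^n q (suc n)))))

constantTerm-1-0 : ∀ f → constantTerm f ≡ 0ℤ → constantTerm (𝟙 ⊞ f) ≡ 1ℤ
constantTerm-1-0 f p = ≡.trans (coeff-⊞ 𝟙 f 0 0 0 0) (≡.cong₂ ℤ._+_ (coeff-𝟙 0 0 0 0) p)

constantTerm-D : ∀ n → constantTerm (D n) ≡ 1ℤ
constantTerm-D zero    = ≡.refl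
constantTerm-D (suc n) = ≡.trans (≐⇒≈ {D (suc n)} {D n ⊠ (𝟙 ⊞ ⊟ Q)} (D-suc n) 0 0 0 0)
  (≡.trans (constantTerm-⊠ (D n) (𝟙 ⊞ ⊟ Q)) (≡.cong₂ ℤ._*_ (constantTerm-D n)
    (constantTerm-1-0 (⊟ Q) (≡.trans (coeff-⊟ Q 0 0 0 0) (≡.cong ℤ.-_
      (≡.trans (constantTerm-⊠ (q ⋆ suc n) (q ⋆ suc n))
        (≡.cong (ℤ._* constantTerm (q ⋆ suc n)) (q-⊠-zero (q ⋆ n) 0 0 0))))))))
  where
  Q : PowerSeries
  Q = q ⋆ suc n ⊠ q ⋆ suc n

denominator-inverse : ∀ a b c → D a ⊠ D b ⊠ D c ⊠ inverse a b c ≐ 𝟙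
denominator-inverse a b c = begin
  D a ⊠ D b ⊠ D c ⊠ inverse a b c
    ≈⟨ O.*-cong (O.sym (denominator-≐ a b c))
         (≈⇒≐ {inverse a b c} {denominator a b c ⁻¹} (inverse-split a b c)) ⟩
  denominator a b c ⊠ denominator a b c ⁻¹
    ≈⟨ ⊠-inverseʳ {denominator a b c} (≡.trans
         (≐⇒≈ {denominator a b c} {D a ⊠ D b ⊠ D c} (denominator-≐ a b c) 0 0 0 0)
         (≡.trans (constantTerm-⊠ (D a ⊠ D b) (D c)) (≡.cong₂ ℤ._*_
           (≡.trans (constantTerm-⊠ (D a) (D b))
             (≡.cong₂ ℤ._*_ (constantTerm-D a) (constantTerm-D b)))
           (constantTerm-D c)))) ⟩
  𝟙 ∎
  where open ≐-Reasoning

-- Scaled so that (1 − q²ᵃ) t = (1 + qᵃ⁺ᵇ⁺ᶜ) P₁, and similarly for P₂ and P₃; the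
-- relations are stated below without subtraction.
P₁ P₂ P₃ : ℕ → ℕ → ℕ → PowerSeries
P₁ = previous 𝟘 R (λ a b c → q ⋆ a ⊠ q ⋆ a ⊠ q ⋆ a ⊠ q ⋆ b ⊠ q ⋆ c ⊠ t a b c)
P₂ = previous 𝟘 G (λ a b c → q ⋆ a ⊠ q ⋆ b ⊠ q ⋆ c ⊠ t a b c)
P₃ = previous 𝟘 B (λ a b c → q ⋆ a ⊠ q ⋆ b ⊠ q ⋆ c ⊠ t a b c)

-- Raising a by 1 adds 3a + b + c to the exponent of q and brings one new factor 1 + qⁿ with n = a +
-- b + c + 1 to the numerator and one new factor 1 - q²ᵃ⁺² to the denominator; `ratio` combines the
-- three. For a = 0 both 1 - A² and `P₁` are zero.
t-rec₁ : ∀ a b c → t a b c ≐ q ⋆ a ⊠ q ⋆ a ⊠ t a b c ⊞ (𝟙 ⊞ q ⋆ a ⊠ q ⋆ b ⊠ q ⋆ c) ⊠ P₁ a b c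
t-rec₁ zero    b c = O.sym (I.1*1*x+y*0≈x (t zero b c) _)
t-rec₁ (suc a) b c = I.ratio
  {e = q ⋆ exponent a b c} {e′ = q ⋆ exponent (suc a) b c}
  {p = poch (a ℕ.+ b ℕ.+ c)} {i = inverse a b c} {i′ = inverse (suc a) b c}
  (q⋆-exponent-suc (exponent a b c) (exponent (suc a) b c) (a ℕ.+ a ℕ.+ a ℕ.+ b ℕ.+ c) (exponent-suc₁ a b c)
    (O.trans (q⋆-sum (a ℕ.+ a ℕ.+ a) b c) (O.*-congʳ (O.*-congʳ (q⋆-sum a a a)))))
  (O.trans (poch-suc (a ℕ.+ b ℕ.+ c)) (O.*-congˡ (O.+-congˡ (q⋆-sum (suc a) b c))))
  (O.trans (O.*-congʳ (O.*-congʳ (D-suc a))) (I.xv*y*z≈x*y*z*v (D a) _ (D b) (D c)))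
  (denominator-inverse a b c) (denominator-inverse (suc a) b c)

t-rec₂ : ∀ a b c → t a b c ≐ q ⋆ b ⊠ q ⋆ b ⊠ t a b c ⊞ (𝟙 ⊞ q ⋆ a ⊠ q ⋆ b ⊠ q ⋆ c) ⊠ P₂ a b c
t-rec₂ a zero    c = O.sym (I.1*1*x+y*0≈x (t a zero c) _)
t-rec₂ a (suc b) c = I.ratio
  {e = q ⋆ exponent a b c} {e′ = q ⋆ exponent a (suc b) c}
  {p = poch (a ℕ.+ b ℕ.+ c)} {i = inverse a b c} {i′ = inverse a (suc b) c}
  (q⋆-exponent-suc (exponent a b c) (exponent a (suc b) c)
    (a ℕ.+ b ℕ.+ c) (exponent-suc₂ a b c) (q⋆-sum a b c))
  (O.trans (≡.subst (λ n → poch n ≐ poch (a ℕ.+ b ℕ.+ c) ⊠ (𝟙 ⊞ q ⋆ n))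
      (≡.cong (ℕ._+ c) (≡.sym (ℕ.+-suc a b))) (poch-suc (a ℕ.+ b ℕ.+ c)))
    (O.*-congˡ (O.+-congˡ (q⋆-sum a (suc b) c))))
  (O.trans (O.*-congʳ (O.*-congˡ (D-suc b))) (I.x*yv*z≈x*y*z*v (D a) (D b) _ (D c)))
  (denominator-inverse a b c) (denominator-inverse a (suc b) c)

t-rec₃ : ∀ a b c → t a b c ≐ q ⋆ c ⊠ q ⋆ c ⊠ t a b c ⊞ (𝟙 ⊞ q ⋆ a ⊠ q ⋆ b ⊠ q ⋆ c) ⊠ P₃ a b c
t-rec₃ a b zero    = O.sym (I.1*1*x+y*0≈x (t a b zero) _)
t-rec₃ a b (suc c) = I.ratio
  {e = q ⋆ exponent a b c} {e′ = q ⋆ exponent a b (suc c)}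
  {p = poch (a ℕ.+ b ℕ.+ c)} {i = inverse a b c} {i′ = inverse a b (suc c)}
  (q⋆-exponent-suc (exponent a b c) (exponent a b (suc c))
    (a ℕ.+ b ℕ.+ c) (exponent-suc₃ a b c) (q⋆-sum a b c))
  (O.trans (≡.subst (λ n → poch n ≐ poch (a ℕ.+ b ℕ.+ c) ⊠ (𝟙 ⊞ q ⋆ n))
      (≡.sym (ℕ.+-suc (a ℕ.+ b) c)) (poch-suc (a ℕ.+ b ℕ.+ c)))
    (O.*-congˡ (O.+-congˡ (q⋆-sum a b (suc c)))))
  (O.trans (O.*-congˡ (D-suc c)) (O.sym (O.*-assoc _ _ _)))
  (denominator-inverse a b c) (denominator-inverse a b (suc c))

t-origin : t 0 0 0 ≐ 𝟙
t-origin = begin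
  𝟙 ⊠ (1# ⊠ inverse 0 0 0)             ≡⟨ ≡.cong (λ x → 𝟙 ⊠ (x ⊠ inverse 0 0 0)) 1≡𝟙 ⟩
  𝟙 ⊠ (𝟙 ⊠ inverse 0 0 0)              ≈⟨ I.1*[1*x]≈1*1*1*x (inverse 0 0 0) ⟩
  𝟙 ⊠ 𝟙 ⊠ 𝟙 ⊠ inverse 0 0 0            ≡⟨ ≡.cong (λ x → x ⊠ x ⊠ x ⊠ inverse 0 0 0) 1≡𝟙 ⟨
  1# ⊠ 1# ⊠ 1# ⊠ inverse 0 0 0         ≈⟨ denominator-inverse 0 0 0 ⟩
  𝟙                                    ∎
  where open ≐-Reasoning

-- Recurrences for the coefficients of the right-hand sides

module F a b c = I.Forms (q ⋆ a) (q ⋆ b) (q ⋆ c) (t a b c) (P₁ a b c) (P₂ a b c) (P₃ a b c)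
module Rec a b c = F.Recurrence a b c (t-rec₁ a b c) (t-rec₂ a b c) (t-rec₃ a b c)

Key : ℕ → ℕ → ℕ → Set
Key a b c = q ⋆ c ⊠ t a b c ⊞ q ⋆ a ⊠ q ⋆ b ⊠ P₃ a b c ≐
  q ⋆ a ⊠ q ⋆ b ⊠ t a b c ⊞ q ⋆ a ⊠ q ⋆ a ⊠ q ⋆ c ⊠ P₂ a b c ⊞ q ⋆ c ⊠ P₁ a b c

key : ∀ a b c → Key a b c
key a b c = by-degree (a ℕ.+ b ℕ.+ c) ≡.refl
  where
  origin : ∀ {a b c} → a ≡ 0 → b ≡ 0 → c ≡ 0 → Key a b c
  origin ≡.refl ≡.refl ≡.refl = I.key-origin (t 0 0 0)

  by-degree : ∀ n → a ℕ.+ b ℕ.+ c ≡ n → Key a b c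
  -- At the origin 1 + ABC has constant term 2 and no inverse over ℤ. There `P₁`, `P₂`, `P₃` are
  -- zero and both sides reduce to `t 0 0 0`.
  by-degree zero    eq = origin
    (ℕ.m+n≡0⇒m≡0 a (ℕ.m+n≡0⇒m≡0 (a ℕ.+ b) eq)) (ℕ.m+n≡0⇒n≡0 a (ℕ.m+n≡0⇒m≡0 (a ℕ.+ b) eq))
    (ℕ.m+n≡0⇒n≡0 (a ℕ.+ b) eq)
  by-degree (suc n) eq = Rec.key a b c λ p → I.invertible-cancelˡ (⊠-inverseʳ {𝟙 ⊞ N} ct) p
    where
    N : PowerSeries
    N = q ⋆ a ⊠ q ⋆ b ⊠ q ⋆ c

    ct : constantTerm (𝟙 ⊞ N) ≡ 1ℤ
    ct = constantTerm-1-0 N (≡.trans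
      (≡.sym (≐⇒≈ {q ⋆ (a ℕ.+ b ℕ.+ c)} {N} (q⋆-sum a b c) 0 0 0 0))
      (≡.trans (≡.cong (λ m → constantTerm (q ⋆ m)) eq) (q-⊠-zero (q ⋆ n) 0 0 0)))

-- States and the q-difference system

-- What the parts of size at most m impose on those of size m + 1 and m + 2.
data State : Set where
  free noR afterRG afterB : State

after : Color → State
after R = afterRG
after G = afterRG
after B = afterB

skip : State → State
skip free    = free
skip noR     = free
skip afterRG = noR
skip afterB  = free

allowed : State → List Color
allowed free    = R ∷ G ∷ B ∷ []
allowed noR     = G ∷ B ∷ []
allowed afterRG = G ∷ []
allowed afterB  = B ∷ []

∑ᴸ : ∀ {A : Set} → (A → PowerSeries) → List A → PowerSeries
∑ᴸ f []       = 𝟘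
∑ᴸ f (x ∷ xs) = f x ⊞ ∑ᴸ f xs

N : ℕ → ℕ → ℕ → PowerSeries
N a b c = q ⋆ a ⊠ q ⋆ b ⊠ q ⋆ c

h : State → ℕ → ℕ → ℕ → PowerSeries
h free    = F.hᵃ
h noR     = F.hᵇ
h afterRG = F.hᶜ
h afterB  = F.hᵈ

-- The contribution of the partitions that contain 1 in color `col`: the factor q is this part
-- itself, `N` raises all remaining parts by 1, and `previous` records the color.
step : Color → ℕ → ℕ → ℕ → PowerSeries
step col = previous 𝟘 col (λ a b c → q ⊠ N a b c ⊠ h (after col) a b c)

-- The factors multiplying `P₁`, `P₂`, `P₃` in the recurrences come from here: red and green lead to
-- the coefficient A³BC²t of `afterRG`, blue to A²B²Ct of `afterB`, and each is divided by the
-- monomial built into the corresponding P.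
step-R : ∀ a b c → step R a b c ≐ N a b c ⊠ (q ⋆ c ⊠ P₁ a b c)
step-R zero    b c = O.sym (I.*-cancel-zero (N 0 b c) (q ⋆ c))
step-R (suc a) b c = I.shift₁ q (q ⋆ a) (q ⋆ b) (q ⋆ c) (t a b c)

step-G : ∀ a b c → step G a b c ≐ N a b c ⊠ (q ⋆ a ⊠ q ⋆ a ⊠ q ⋆ c ⊠ P₂ a b c)
step-G a zero    c = O.sym (I.*-cancel-zero (N a 0 c) (q ⋆ a ⊠ q ⋆ a ⊠ q ⋆ c))
step-G a (suc b) c = I.shift₂ q (q ⋆ a) (q ⋆ b) (q ⋆ c) (t a b c)

step-B : ∀ a b c → step B a b c ≐ N a b c ⊠ (q ⋆ a ⊠ q ⋆ b ⊠ P₃ a b c)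
step-B a b zero    = O.sym (I.*-cancel-zero (N a b 0) (q ⋆ a ⊠ q ⋆ b))
step-B a b (suc c) = I.shift₃ q (q ⋆ a) (q ⋆ b) (q ⋆ c) (t a b c)

h-rec : ∀ s a b c →
        h s a b c ≐ N a b c ⊠ h (skip s) a b c ⊞ ∑ᴸ (λ col → step col a b c) (allowed s)
h-rec s a b c = O.trans (identity s) (O.+-congˡ (O.sym (steps s)))
  where
  R′ G′ B′ : PowerSeries
  R′ = N a b c ⊠ (q ⋆ c ⊠ P₁ a b c)
  G′ = N a b c ⊠ (q ⋆ a ⊠ q ⋆ a ⊠ q ⋆ c ⊠ P₂ a b c)
  B′ = N a b c ⊠ (q ⋆ a ⊠ q ⋆ b ⊠ P₃ a b c)

  total : State → PowerSeries
  total free    = R′ ⊞ (G′ ⊞ B′)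
  total noR     = G′ ⊞ B′
  total afterRG = G′
  total afterB  = B′

  identity : ∀ s → h s a b c ≐ N a b c ⊠ h (skip s) a b c ⊞ total s
  identity free    = Rec.hᵃ-rec a b c (key a b c)
  identity noR     = Rec.hᵇ-rec a b c
  identity afterRG = Rec.hᶜ-rec a b c
  identity afterB  = Rec.hᵈ-rec a b c

  step-B₀ : step B a b c ⊞ 𝟘 ≐ B′
  step-B₀ = O.trans (O.+-identityʳ _) (step-B a b c)

  steps : ∀ s → ∑ᴸ (λ col → step col a b c) (allowed s) ≐ total s
  steps free    = O.+-cong (step-R a b c) (O.+-cong (step-G a b c) step-B₀)
  steps noR     = O.+-cong (step-G a b c) step-B₀
  steps afterRG = O.trans (O.+-identityʳ _) (step-G a b c)
  steps afterB  = step-B₀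

-- The generating function of the partitions into parts of size greater than m
-- that are admissible in the state s.
𝕊 : State → ℕ → PowerSeries
𝕊 s m = rows (λ a b c → N a b c ⋆ m ⊠ h s a b c)

∑ᴸ-rows : ∀ {A : Set} (f : ℕ → ℕ → ℕ → PowerSeries) (g : A → ℕ → ℕ → ℕ → PowerSeries) xs →
          rows (λ a b c → f a b c ⊠ ∑ᴸ (λ x → g x a b c) xs) ≐
          ∑ᴸ (λ x → rows (λ a b c → f a b c ⊠ g x a b c)) xs
∑ᴸ-rows f g []       = O.trans (rows-cong λ a b c → O.zeroʳ (f a b c)) rows-𝟘
∑ᴸ-rows f g (x ∷ xs) = O.trans (rows-cong λ a b c → O.distribˡ (f a b c) _ _)
  (O.trans (rows-⊞ (λ a b c → f a b c ⊠ g x a b c) (λ a b c → f a b c ⊠ ∑ᴸ (λ x → g x a b c) xs))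
    (O.+-congˡ (∑ᴸ-rows f g xs)))

∑ᴸ-cong : ∀ {A : Set} {f g : A → PowerSeries} → (∀ x → f x ≐ g x) → ∀ xs → ∑ᴸ f xs ≐ ∑ᴸ g xs
∑ᴸ-cong p []       = O.refl
∑ᴸ-cong p (x ∷ xs) = O.+-cong (p x) (∑ᴸ-cong p xs)

𝕊-step : ∀ m col → rows (λ a b c → N a b c ⋆ m ⊠ step col a b c) ≐
         y col ⊠ (q ⋆ suc m ⊠ 𝕊 (after col) (suc m))
𝕊-step m col = O.sym (begin
  y col ⊠ (q ⋆ suc m ⊠ 𝕊 (after col) (suc m))
    ≈⟨ O.*-congˡ (q⋆-⊠-rows (suc m) (λ a b c → N a b c ⋆ suc m ⊠ h (after col) a b c)) ⟩
  y col ⊠ rows r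
    ≈⟨ y-⊠-rows col r ⟩
  rows (previous 𝟘 col r)
    ≈⟨ rows-cong (pointwise col) ⟩
  rows (λ a b c → N a b c ⋆ m ⊠ step col a b c) ∎)
  where
  open ≐-Reasoning
  r : ℕ → ℕ → ℕ → PowerSeries
  r a b c = q ⋆ suc m ⊠ (N a b c ⋆ suc m ⊠ h (after col) a b c)

  pointwise : ∀ col a b c →
    previous 𝟘 col (λ a b c → q ⋆ suc m ⊠ (N a b c ⋆ suc m ⊠ h (after col) a b c)) a b c ≐
    N a b c ⋆ m ⊠ step col a b c
  pointwise R zero    b       c       = O.sym (O.zeroʳ _)
  pointwise R (suc a) b       c       = I.shift-power q (N a b c) (h afterRG a b c) m
    (I.q*A*B*C≈q*[A*B*C] q (q ⋆ a) (q ⋆ b) (q ⋆ c))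
  pointwise G a       zero    c       = O.sym (O.zeroʳ _)
  pointwise G a       (suc b) c       = I.shift-power q (N a b c) (h afterRG a b c) m
    (I.A*[q*B]*C≈q*[A*B*C] q (q ⋆ a) (q ⋆ b) (q ⋆ c))
  pointwise B a       b       zero    = O.sym (O.zeroʳ _)
  pointwise B a       b       (suc c) = I.shift-power q (N a b c) (h afterB a b c) m
    (I.A*B*[q*C]≈q*[A*B*C] q (q ⋆ a) (q ⋆ b) (q ⋆ c))

𝕊-rec : ∀ s m → 𝕊 s m ≐ 𝕊 (skip s) (suc m) ⊞
        ∑ᴸ (λ col → y col ⊠ (q ⋆ suc m ⊠ 𝕊 (after col) (suc m))) (allowed s)
𝕊-rec s m = begin
  𝕊 s m
    ≈⟨ rows-cong (λ a b c → I.power-rec (N a b c) m _ _ _ (h-rec s a b c)) ⟩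
  rows (λ a b c → N a b c ⋆ suc m ⊠ h (skip s) a b c
                ⊞ N a b c ⋆ m ⊠ ∑ᴸ (λ col → step col a b c) (allowed s))
    ≈⟨ rows-⊞ (λ a b c → N a b c ⋆ suc m ⊠ h (skip s) a b c)
         (λ a b c → N a b c ⋆ m ⊠ ∑ᴸ (λ col → step col a b c) (allowed s)) ⟩
  𝕊 (skip s) (suc m) ⊞ rows (λ a b c → N a b c ⋆ m ⊠ ∑ᴸ (λ col → step col a b c) (allowed s))
    ≈⟨ O.+-congˡ (∑ᴸ-rows (λ a b c → N a b c ⋆ m) step (allowed s)) ⟩
  𝕊 (skip s) (suc m) ⊞ ∑ᴸ (λ col → rows (λ a b c → N a b c ⋆ m ⊠ step col a b c)) (allowed s)
    ≈⟨ O.+-congˡ (∑ᴸ-cong (𝕊-step m) (allowed s)) ⟩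
  𝕊 (skip s) (suc m) ⊞ ∑ᴸ (λ col → y col ⊠ (q ⋆ suc m ⊠ 𝕊 (after col) (suc m))) (allowed s) ∎
  where open ≐-Reasoning

-- Congruence modulo powers of q

infix 4 _≐[_]_

_≐[_]_ : PowerSeries → ℕ → PowerSeries → Set
f ≐[ n ] g = ∀ a b c d → d < n → f a b c d ≡ g a b c d

⊞-cong[] : ∀ {n f f′ g g′} → f ≐[ n ] f′ → g ≐[ n ] g′ → f ⊞ g ≐[ n ] f′ ⊞ g′
⊞-cong[] {n} {f} {f′} {g} {g′} p p′ a b c d lt = ≡.trans (coeff-⊞ f g a b c d)
  (≡.trans (≡.cong₂ ℤ._+_ (p a b c d lt) (p′ a b c d lt)) (≡.sym (coeff-⊞ f′ g′ a b c d)))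

y-⊠-cong[] : ∀ {n f g} col → f ≐[ n ] g → y col ⊠ f ≐[ n ] y col ⊠ g
y-⊠-cong[] {n} {f} {g} col p a b c d lt =
  ≡.trans (y-⊠ col f a b c d) (≡.trans (lemma col a b c) (≡.sym (y-⊠ col g a b c d)))
  where
  lemma : ∀ col a b c → previous (λ _ → 0ℤ) col f a b c d ≡ previous (λ _ → 0ℤ) col g a b c d
  lemma R zero    b       c       = ≡.refl
  lemma R (suc a) b       c       = p a b c d lt
  lemma G a       zero    c       = ≡.refl
  lemma G a       (suc b) c       = p a b c d lt
  lemma B a       b       zero    = ≡.refl
  lemma B a       b       (suc c) = p a b c d lt

q-⊠-cong[] : ∀ {n f g} → f ≐[ n ] g → q ⊠ f ≐[ n ] q ⊠ g
q-⊠-cong[] {n} {f} {g} p a b c zero    lt =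
  ≡.trans (q-⊠-zero f a b c) (≡.sym (q-⊠-zero g a b c))
q-⊠-cong[] {n} {f} {g} p a b c (suc d) lt =
  ≡.trans (q-⊠-suc f a b c d) (≡.trans (p a b c d (ℕ.<-trans (ℕ.n<1+n d) lt))
    (≡.sym (q-⊠-suc g a b c d)))

≐[]-resp : ∀ {n f f′ g g′} → f ≐ f′ → g ≐ g′ → f′ ≐[ n ] g′ → f ≐[ n ] g
≐[]-resp {n} {f} {f′} {g} {g′} p p′ r a b c d lt = ≡.trans (≐⇒≈ {f} {f′} p a b c d)
  (≡.trans (r a b c d lt) (≡.sym (≐⇒≈ {g} {g′} p′ a b c d)))

q⋆-⊠-cong[] : ∀ {n f g} m → f ≐[ n ] g → q ⋆ m ⊠ f ≐[ n ] q ⋆ m ⊠ g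
q⋆-⊠-cong[] {n} {f} {g} zero    p =
  ≐[]-resp {f = 𝟙 ⊠ f} {f} {𝟙 ⊠ g} {g} (O.*-identityˡ f) (O.*-identityˡ g) p
q⋆-⊠-cong[] {n} {f} {g} (suc m) p =
  ≐[]-resp {f = q ⊠ q ⋆ m ⊠ f} {q ⊠ (q ⋆ m ⊠ f)} {q ⊠ q ⋆ m ⊠ g} {q ⊠ (q ⋆ m ⊠ g)}
    (O.*-assoc q (q ⋆ m) f) (O.*-assoc q (q ⋆ m) g)
    (q-⊠-cong[] {n} {q ⋆ m ⊠ f} {q ⋆ m ⊠ g} (q⋆-⊠-cong[] m p))

q⋆-⊠-low : ∀ m f → q ⋆ m ⊠ f ≐[ m ] 𝟘
q⋆-⊠-low (suc m) f a b c d lt = ≡.trans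
  (≐⇒≈ {q ⊠ q ⋆ m ⊠ f} {q ⊠ (q ⋆ m ⊠ f)} (O.*-assoc q (q ⋆ m) f) a b c d) (≡.trans (low d lt)
    (≡.sym (coeff-𝟘 a b c d)))
  where
  low : ∀ d → d < suc m → (q ⊠ (q ⋆ m ⊠ f)) a b c d ≡ 0ℤ
  low zero    _        = q-⊠-zero (q ⋆ m ⊠ f) a b c
  low (suc d) (s≤s lt) = ≡.trans (q-⊠-suc (q ⋆ m ⊠ f) a b c d)
    (≡.trans (q⋆-⊠-low m f a b c d lt) (coeff-𝟘 a b c d))

-- This is the initial condition of the system. Every row except the origin carries the m-th power
-- of `N`, a multiple of q there; the origin row is `t 0 0 0`, which is 1.
𝕊-low : ∀ s m → 𝕊 s m ≐[ m ] 𝟙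
𝕊-low s m = low
  where
  h-origin : ∀ s → h s 0 0 0 ≐ 𝟙
  h-origin free    = I.hᵃ-origin t-origin
  h-origin noR     = I.hᵇ-origin t-origin
  h-origin afterRG = I.hᶜ-origin t-origin
  h-origin afterB  = I.hᵈ-origin t-origin

  vanish : ∀ {n} k x → n ≐ q ⊠ k → n ⋆ m ⊠ x ≐[ m ] 𝟘
  vanish {n} k x p = ≐[]-resp {f = n ⋆ m ⊠ x} {q ⋆ m ⊠ (k ⋆ m ⊠ x)} {𝟘} {𝟘}
    (O.trans (O.*-congʳ (O.trans (I.^-congˡ m p) (I.^-distrib-* q k m))) (O.*-assoc _ _ _))
    O.refl (q⋆-⊠-low m (k ⋆ m ⊠ x))

  zero-row : ∀ {n} k x {z} d → d < m → n ≐ q ⊠ k → z ≡ 0ℤ → (n ⋆ m ⊠ x) 0 0 0 d ≡ z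
  zero-row k x d lt p z≡0 = ≡.trans (vanish k x p 0 0 0 d lt)
    (≡.trans (coeff-𝟘 0 0 0 d) (≡.sym z≡0))

  origin : N 0 0 0 ⋆ m ⊠ h s 0 0 0 ≐ 𝟙
  origin = O.trans (O.*-cong (O.trans (I.^-congˡ m (O.trans (O.*-identityʳ _) (O.*-identityʳ _)))
    (I.1^n≈1 m)) (h-origin s)) (O.*-identityʳ 𝟙)

  low : 𝕊 s m ≐[ m ] 𝟙
  low zero    zero    zero    d lt = ≐⇒≈ {N 0 0 0 ⋆ m ⊠ h s 0 0 0} {𝟙} origin 0 0 0 d
  low zero    zero    (suc c) d lt = zero-row (N 0 0 c) (h s 0 0 (suc c)) d lt
    (I.A*B*[q*C]≈q*[A*B*C] q 𝟙 𝟙 (q ⋆ c)) (coeff-𝟙 0 0 (suc c) d)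
  low zero    (suc b) c       d lt = zero-row (N 0 b c) (h s 0 (suc b) c) d lt
    (I.A*[q*B]*C≈q*[A*B*C] q 𝟙 (q ⋆ b) (q ⋆ c)) (coeff-𝟙 0 (suc b) c d)
  low (suc a) b       c       d lt = zero-row (N a b c) (h s (suc a) b c) d lt
    (I.q*A*B*C≈q*[A*B*C] q (q ⋆ a) (q ⋆ b) (q ⋆ c)) (coeff-𝟙 (suc a) b c d)

-- Partitions of smallest part greater than m

excluded : State → ℕ → List Part
excluded free    m = []
excluded noR     m = (suc m , R) ∷ []
excluded afterRG m = (suc m , R) ∷ (suc (suc m) , R) ∷ (suc m , B) ∷ []
excluded afterB  m = (suc m , R) ∷ (suc m , G) ∷ []

excludedBy≡ : ∀ j c → excludedBy (j , c) ≡ excluded (after c) j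
excludedBy≡ j R rewrite ℕ.+-comm j 1 | ℕ.+-comm j 2 = ≡.refl
excludedBy≡ j G rewrite ℕ.+-comm j 1 | ℕ.+-comm j 2 = ≡.refl
excludedBy≡ j B rewrite ℕ.+-comm j 1 = ≡.refl

excluded-size : ∀ s m {e} → e ∈ excluded s m → m < size e
excluded-size noR     m (here ≡.refl)                 = ℕ.≤-refl
excluded-size afterRG m (here ≡.refl)                 = ℕ.≤-refl
excluded-size afterRG m (there (here ≡.refl))         = ℕ.n≤1+n _
excluded-size afterRG m (there (there (here ≡.refl))) = ℕ.≤-refl
excluded-size afterB  m (here ≡.refl)                 = ℕ.≤-refl
excluded-size afterB  m (there (here ≡.refl))         = ℕ.≤-refl

excluded-skip : ∀ s m {e} → e ∈ excluded (skip s) (suc m) → e ∈ excluded s m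
excluded-skip afterRG m (here ≡.refl) = there (here ≡.refl)

excluded-above : ∀ s m {e} → suc m < size e → e ∈ excluded s m → e ∈ excluded (skip s) (suc m)
excluded-above noR     m lt (here ≡.refl)                 = contradiction lt (ℕ.<-irrefl ≡.refl)
excluded-above afterRG m lt (here ≡.refl)                 = contradiction lt (ℕ.<-irrefl ≡.refl)
excluded-above afterRG m lt (there (here ≡.refl))         = here ≡.refl
excluded-above afterRG m lt (there (there (here ≡.refl))) = contradiction lt (ℕ.<-irrefl ≡.refl)
excluded-above afterB  m lt (here ≡.refl)                 = contradiction lt (ℕ.<-irrefl ≡.refl)
excluded-above afterB  m lt (there (here ≡.refl))         = contradiction lt (ℕ.<-irrefl ≡.refl)

-- This is why no state has to remember two earlier parts. The only exclusion reaching beyond size m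
-- + 1 is (m + 2)_R in the state `afterRG`; the only color allowed there is green, and (m + 1)_G
-- excludes (m + 2)_R again.
excluded-allowed : ∀ s m {c e} → c ∈ allowed s → suc m < size e →
                   e ∈ excluded s m → e ∈ excluded (after c) (suc m)
excluded-allowed noR     m _           lt (here ≡.refl)                 = contradiction lt (ℕ.<-irrefl ≡.refl)
excluded-allowed afterRG m _           lt (here ≡.refl)                 = contradiction lt (ℕ.<-irrefl ≡.refl)
excluded-allowed afterRG m (here ≡.refl) lt (there (here ≡.refl))         = here ≡.refl
excluded-allowed afterRG m _           lt (there (there (here ≡.refl))) = contradiction lt (ℕ.<-irrefl ≡.refl)
excluded-allowed afterB  m _           lt (here ≡.refl)                 = contradiction lt (ℕ.<-irrefl ≡.refl)
excluded-allowed afterB  m _           lt (there (here ≡.refl))         = contradiction lt (ℕ.<-irrefl ≡.refl)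

allowed-∉ : ∀ s m {c} → c ∈ allowed s → (suc m , c) ∉ excluded s m
allowed-∉ noR     m (here ≡.refl)         (here ())
allowed-∉ noR     m (there (here ≡.refl)) (here ())
allowed-∉ afterRG m (here ≡.refl)         (there (there (here ())))
allowed-∉ afterB  m (here ≡.refl)         (there (here ()))

∉-allowed : ∀ s m c → (suc m , c) ∉ excluded s m → c ∈ allowed s
∉-allowed free    m R _  = here ≡.refl
∉-allowed free    m G _  = there (here ≡.refl)
∉-allowed free    m B _  = there (there (here ≡.refl))
∉-allowed noR     m R ∉e = contradiction (here ≡.refl) ∉e
∉-allowed noR     m G _  = here ≡.refl
∉-allowed noR     m B _  = there (here ≡.refl)
∉-allowed afterRG m R ∉e = contradiction (here ≡.refl) ∉e
∉-allowed afterRG m G _  = here ≡.refl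
∉-allowed afterRG m B ∉e = contradiction (there (there (here ≡.refl))) ∉e
∉-allowed afterB  m R ∉e = contradiction (here ≡.refl) ∉e
∉-allowed afterB  m G ∉e = contradiction (there (here ≡.refl)) ∉e
∉-allowed afterB  m B _  = here ≡.refl

allowed-unique : ∀ s → Unique (allowed s)
allowed-unique free    = ((λ ()) ∷ (λ ()) ∷ []) ∷ ((λ ()) ∷ []) ∷ [] ∷ []
allowed-unique noR     = ((λ ()) ∷ []) ∷ [] ∷ []
allowed-unique afterRG = [] ∷ []
allowed-unique afterB  = [] ∷ []

record Admissible (s : State) (m : ℕ) (π : List Part) : Set where
  constructor admissible
  field
    inΛ      : Λ π
    above    : All (λ p → m < size p) π
    avoiding : All (_∉ excluded s m) π

open Admissible

[]-admissible : ∀ s m → Admissible s m []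
[]-admissible s m = admissible (([] , []) , [] , []) [] []

Linked-∷ : ∀ {p π} → All (λ x → size p < size x) π → Linked _≼_ π → Linked _≼_ (p ∷ π)
Linked-∷ []        []       = [-]
Linked-∷ (lt ∷ _)  [-]      = inj₁ lt ∷ [-]
Linked-∷ (lt ∷ _)  (r ∷ rs) = inj₁ lt ∷ r ∷ rs

Linked-tail : ∀ {p π} → Linked _≼_ (p ∷ π) → Linked _≼_ π
Linked-tail [-]     = []
Linked-tail (_ ∷ l) = l

Linked-≤ : ∀ {p π} → Linked _≼_ (p ∷ π) → All (λ x → size p ≤ size x) π
Linked-≤ [-]                      = []
Linked-≤ {p} (_∷_ {y = x} p≼x l)  = p≤x p≼x ∷ All.map (ℕ.≤-trans (p≤x p≼x)) (Linked-≤ l)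
  where
  p≤x : p ≼ x → size p ≤ size x
  p≤x (inj₁ lt)       = ℕ.<⇒≤ lt
  p≤x (inj₂ (eq , _)) = ℕ.≤-reflexive eq

Λ-tail : ∀ {p π} → Λ (p ∷ π) → Λ π
Λ-tail ((_ ∷ pos , l) , (_ ∷ u) , (_ ∷ ex)) =
  (pos , Linked-tail l) , u , All.map (All.map (_∘ there)) ex

Λ-head-< : ∀ {p π} → Λ (p ∷ π) → All (λ x → size p < size x) π
Λ-head-< ((_ , l) , (p∉ ∷ _) , _) =
  All.zipWith (λ (le , ne) → ℕ.≤∧≢⇒< le ne) (Linked-≤ l , map⁻ p∉)

skip-admissible : ∀ {s m π} → Admissible (skip s) (suc m) π → Admissible s m π
skip-admissible {s} {m} (admissible inΛ above avoiding) = admissible inΛ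
  (All.map (ℕ.<-trans (ℕ.n<1+n m)) above)
  (All.zipWith (λ (lt , ∉e) e∈ → ∉e (excluded-above s m lt e∈)) (above , avoiding))

admissible-skip : ∀ {s m π} → Admissible s m π → All (λ p → suc m < size p) π →
                  Admissible (skip s) (suc m) π
admissible-skip {s} {m} a above′ = admissible (inΛ a) above′
  (All.map (λ ∉e e∈ → ∉e (excluded-skip s m e∈)) (avoiding a))

∷-admissible : ∀ {s m c π} → c ∈ allowed s → Admissible (after c) (suc m) π →
               Admissible s m ((suc m , c) ∷ π)
∷-admissible {s} {m} {c} {π} c∈ (admissible ((pos , l) , u , ex) above avoiding) = admissible
  ( (s≤s z≤n ∷ pos , Linked-∷ above l)
  , map⁺ (All.map ℕ.<⇒≢ above) ∷ u
  , All.tabulate head-excludes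
    ∷ All.zipWith (λ (lt , ∉s) → All.zipWith not-head (bigger _ lt , ∉s)) (above , ex) )
  (ℕ.≤-refl ∷ All.map (ℕ.<-trans (ℕ.n<1+n m)) above)
  (allowed-∉ s m c∈ ∷ All.zipWith (λ (lt , ∉e) e∈ → ∉e (excluded-allowed s m c∈ lt e∈)) (above , avoiding))
  where
  ∉-∷ : ∀ {e : Part} → suc m < size e → e ∉ π → e ∉ (suc m , c) ∷ π
  ∉-∷ lt e∉ (here ≡.refl) = ℕ.<-irrefl ≡.refl lt
  ∉-∷ lt e∉ (there e∈)  = e∉ e∈

  not-head : ∀ {e} → suc m < size e × e ∉ π → e ∉ (suc m , c) ∷ π
  not-head (lt , e∉) = ∉-∷ lt e∉

  excludedBy-size : ∀ p {e} → e ∈ excludedBy p → size p < size e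
  excludedBy-size (j , d) {e} e∈ = excluded-size (after d) j (≡.subst (e ∈_) (excludedBy≡ j d) e∈)

  bigger : ∀ p → suc m < size p → All (λ e → suc m < size e) (excludedBy p)
  bigger p lt = All.tabulate λ e∈ → ℕ.<-trans lt (excludedBy-size p e∈)

  head-excludes : ∀ {e} → e ∈ excludedBy (suc m , c) → e ∉ (suc m , c) ∷ π
  head-excludes {e} e∈ = ∉-∷ (excludedBy-size (suc m , c) e∈) λ e∈π →
    All.lookup avoiding e∈π (≡.subst (e ∈_) (excludedBy≡ (suc m) c) e∈)

admissible-∷ : ∀ {s m c π} → Admissible s m ((suc m , c) ∷ π) →
               c ∈ allowed s × Admissible (after c) (suc m) π
admissible-∷ {s} {m} {c} {π} (admissible inΛ _ (∉e ∷ _)) =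
  ∉-allowed s m c ∉e , admissible (Λ-tail inΛ) (Λ-head-< inΛ) (All.tabulate avoids)
  where
  avoids : ∀ {x} → x ∈ π → x ∉ excluded (after c) (suc m)
  avoids {x} x∈ x∈e = All.lookup (All.head (proj₂ (proj₂ inΛ)))
    (≡.subst (x ∈_) (≡.sym (excludedBy≡ (suc m) c)) x∈e) (there x∈)

-- Enumeration by successive part sizes

enumerate : State → ℕ → ℕ → List (List Part)
enumerate s zero    m = [] ∷ []
enumerate s (suc k) m = enumerate (skip s) k (suc m) ++
  concatMap (λ c → map ((suc m , c) ∷_) (enumerate (after c) k (suc m))) (allowed s)

enumerate-sound : ∀ s k m {π} → π ∈ enumerate s k m → Admissible s m π
enumerate-sound s zero    m (here ≡.refl) = []-admissible s m
enumerate-sound s (suc k) m π∈ with ∈-++⁻ (enumerate (skip s) k (suc m)) π∈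
... | inj₁ i = skip-admissible (enumerate-sound (skip s) k (suc m) i)
... | inj₂ i with find (∈-concatMap⁻ (λ c → map ((suc m , c) ∷_) (enumerate (after c) k (suc m)))
                         {xs = allowed s} i)
...   | c , c∈ , j with ∈-map⁻ ((suc m , c) ∷_) j
...     | ρ , ρ∈ , ≡.refl = ∷-admissible c∈ (enumerate-sound (after c) k (suc m) ρ∈)

enumerate-complete : ∀ s k m {π} → Admissible s m π → All (λ p → size p ≤ m ℕ.+ k) π →
                     π ∈ enumerate s k m
enumerate-complete s zero    m {[]}    a bound = here ≡.refl
enumerate-complete s zero    m {p ∷ π} a (le ∷ _) with above a
... | lt ∷ _ = contradiction (ℕ.<-≤-trans lt (≡.subst (size p ≤_) (ℕ.+-identityʳ m) le)) (ℕ.<-irrefl ≡.refl)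
enumerate-complete s (suc k) m {[]}    a bound =
  ∈-++⁺ˡ (enumerate-complete (skip s) k (suc m) ([]-admissible (skip s) (suc m)) [])
enumerate-complete s (suc k) m {(j , c) ∷ π} a bound with ℕ.m≤n⇒m<n∨m≡n (All.head (above a))
-- The head is the smallest part, so it decides the branch: if it exceeds m + 1, then so do all the
-- others.
... | inj₁ lt = ∈-++⁺ˡ (enumerate-complete (skip s) k (suc m)
  (admissible-skip a (lt ∷ All.map (ℕ.<-trans lt) (Λ-head-< (inΛ a))))
  (All.map (λ {p} le → ≡.subst (size p ≤_) (ℕ.+-suc m k) le) bound))
... | inj₂ ≡.refl = ∈-++⁺ʳ (enumerate (skip s) k (suc m))
  (∈-concatMap⁺ (λ c → map ((suc m , c) ∷_) (enumerate (after c) k (suc m)))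
    (lose (proj₁ (admissible-∷ a)) (∈-map⁺ ((suc m , c) ∷_)
      (enumerate-complete (after c) k (suc m) (proj₂ (admissible-∷ a))
        (All.map (λ {p} le → ≡.subst (size p ≤_) (ℕ.+-suc m k) le) (All.tail bound))))))

concatMap-∷-unique : ∀ j (f : Color → List (List Part)) {cs} → (∀ c → Unique (f c)) → Unique cs →
                     Unique (concatMap (λ c → map ((j , c) ∷_) (f c)) cs)
concatMap-∷-unique j f     u []        = []
concatMap-∷-unique j f {c ∷ cs} u (c∉ ∷ v) = Unique.++⁺
  (Unique.map⁺ (λ { ≡.refl → ≡.refl }) (u c)) (concatMap-∷-unique j f u v) disjoint
  where
  disjoint : ∀ {π} → π ∈ map ((j , c) ∷_) (f c) ×
             π ∈ concatMap (λ c → map ((j , c) ∷_) (f c)) cs → ⊥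
  disjoint (i , i′) with ∈-map⁻ ((j , c) ∷_) i
                       | find (∈-concatMap⁻ (λ c → map ((j , c) ∷_) (f c)) {xs = cs} i′)
  ... | _ , _ , ≡.refl | d , d∈ , i″ with ∈-map⁻ ((j , d) ∷_) i″
  ...   | _ , _ , ≡.refl = All.lookup c∉ d∈ ≡.refl

-- Lists from the first branch have all parts above m + 1, while those from the second begin with a
-- part of size m + 1 whose color tells the sublists apart.
enumerate-unique : ∀ s k m → Unique (enumerate s k m)
enumerate-unique s zero    m = [] ∷ []
enumerate-unique s (suc k) m = Unique.++⁺ (enumerate-unique (skip s) k (suc m))
  (concatMap-∷-unique (suc m) (λ c → enumerate (after c) k (suc m))
    (λ c → enumerate-unique (after c) k (suc m)) (allowed-unique s))
  disjoint
  where
  disjoint : ∀ {π} → π ∈ enumerate (skip s) k (suc m) ×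
    π ∈ concatMap (λ c → map ((suc m , c) ∷_) (enumerate (after c) k (suc m))) (allowed s) → ⊥
  disjoint (i , i′) with find (∈-concatMap⁻ (λ c → map ((suc m , c) ∷_) (enumerate (after c) k (suc m)))
                                {xs = allowed s} i′)
  ... | c , _ , i″ with ∈-map⁻ ((suc m , c) ∷_) i″
  ...   | _ , _ , ≡.refl = ℕ.<-irrefl ≡.refl (All.head (above (enumerate-sound (skip s) k (suc m) i)))

parts≤∣_∣ₚ : ∀ π → All (λ p → size p ≤ ∣ π ∣ₚ) π
parts≤∣ [] ∣ₚ    = []
parts≤∣ p ∷ π ∣ₚ = ℕ.m≤m+n (size p) ∣ π ∣ₚ
  ∷ All.map (λ le → ℕ.≤-trans le (ℕ.m≤n+m ∣ π ∣ₚ (size p))) parts≤∣ π ∣ₚ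

-- Generating functions

colorWeight colorWeight₁₂ : List Part → PowerSeries
colorWeight π = y₁ ^ len R π * y₂ ^ len G π * y₃ ^ len B π
colorWeight₁₂ π = y₁ ^ len R π * y₂ ^ len G π

weight-split : ∀ π a b c d → weight π a b c d ≡ (colorWeight π * q ^ ∣ π ∣ₚ) a b c d
weight-split π a b c d = ≡.refl

colorWeight-split : ∀ π a b c d → colorWeight π a b c d ≡ (colorWeight₁₂ π * y₃ ^ len B π) a b c d
colorWeight-split π a b c d = ≡.refl

colorWeight₁₂-split : ∀ π a b c d → colorWeight₁₂ π a b c d ≡ (y₁ ^ len R π * y₂ ^ len G π) a b c d
colorWeight₁₂-split π a b c d = ≡.refl

weight-≐ : ∀ π → weight π ≐ y₁ ⋆ len R π ⊠ y₂ ⋆ len G π ⊠ y₃ ⋆ len B π ⊠ q ⋆ ∣ π ∣ₚ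
weight-≐ π =
  split-⊠ (colorWeight π) (q ^ ∣ π ∣ₚ) (weight-split π)
  (split-⊠ (colorWeight₁₂ π) (y₃ ^ len B π) (colorWeight-split π)
  (split-⊠ (y₁ ^ len R π) (y₂ ^ len G π) (colorWeight₁₂-split π)
    (^≐⋆ y₁ (len R π)) (^≐⋆ y₂ (len G π))) (^≐⋆ y₃ (len B π))) (^≐⋆ q ∣ π ∣ₚ)

weight-∷ : ∀ c m π → weight ((m , c) ∷ π) ≐ y c ⊠ (q ⋆ m ⊠ weight π)
weight-∷ c m π = O.trans (weight-≐ ((m , c) ∷ π)) (O.trans (O.*-congˡ (q⋆-+ m ∣ π ∣ₚ))
  (O.trans (by-color c) (O.*-congˡ (O.*-congˡ (O.sym (weight-≐ π))))))
  where
  r g b s : PowerSeries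
  r = y₁ ⋆ len R π
  g = y₂ ⋆ len G π
  b = y₃ ⋆ len B π
  s = q ⋆ ∣ π ∣ₚ

  by-color : ∀ c →
    y₁ ⋆ len R ((m , c) ∷ π) ⊠ y₂ ⋆ len G ((m , c) ∷ π) ⊠ y₃ ⋆ len B ((m , c) ∷ π) ⊠ (q ⋆ m ⊠ s) ≐
    y c ⊠ (q ⋆ m ⊠ (r ⊠ g ⊠ b ⊠ s))
  by-color R = I.cons₁ y₁ (q ⋆ m) r g b s
  by-color G = I.cons₂ y₂ (q ⋆ m) r g b s
  by-color B = I.cons₃ y₃ (q ⋆ m) r g b s

weight-[] : weight [] ≐ 𝟙
weight-[] = O.trans (weight-≐ []) (O.trans (O.*-identityʳ _)
  (O.trans (O.*-identityʳ _) (O.*-identityʳ _)))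

Homogeneous : ℕ → PowerSeries → Set
Homogeneous n f = ∀ a b c d → d ≢ n → f a b c d ≡ 0ℤ

y-⊠-homogeneous : ∀ {n f} col → Homogeneous n f → Homogeneous n (y col ⊠ f)
y-⊠-homogeneous {n} {f} col p a b c d d≢n = ≡.trans (y-⊠ col f a b c d) (lemma col a b c)
  where
  lemma : ∀ col a b c → previous (λ _ → 0ℤ) col f a b c d ≡ 0ℤ
  lemma R zero    b       c       = ≡.refl
  lemma R (suc a) b       c       = p a b c d d≢n
  lemma G a       zero    c       = ≡.refl
  lemma G a       (suc b) c       = p a b c d d≢n
  lemma B a       b       zero    = ≡.refl
  lemma B a       b       (suc c) = p a b c d d≢n

homogeneous-resp : ∀ {n f g} → f ≐ g → Homogeneous n g → Homogeneous n f
homogeneous-resp {n} {f} {g} p r a b c d d≢n = ≡.trans (≐⇒≈ {f} {g} p a b c d) (r a b c d d≢n)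

q⋆-⊠-homogeneous : ∀ {n f} m → Homogeneous n f → Homogeneous (m ℕ.+ n) (q ⋆ m ⊠ f)
q⋆-⊠-homogeneous {n} {f} zero    p = homogeneous-resp {f = 𝟙 ⊠ f} {f} (O.*-identityˡ f) p
q⋆-⊠-homogeneous {n} {f} (suc m) p =
  homogeneous-resp {f = q ⊠ q ⋆ m ⊠ f} {q ⊠ (q ⋆ m ⊠ f)} (O.*-assoc q (q ⋆ m) f) lemma
  where
  lemma : Homogeneous (suc (m ℕ.+ n)) (q ⊠ (q ⋆ m ⊠ f))
  lemma a b c zero    _   = q-⊠-zero (q ⋆ m ⊠ f) a b c
  lemma a b c (suc d) d≢n = ≡.trans (q-⊠-suc (q ⋆ m ⊠ f) a b c d)
    (q⋆-⊠-homogeneous m p a b c d (λ eq → d≢n (≡.cong suc eq)))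

weight-homogeneous : ∀ π → Homogeneous ∣ π ∣ₚ (weight π)
weight-homogeneous []            = homogeneous-resp {f = weight []} {𝟙} weight-[] lemma
  where
  lemma : Homogeneous 0 𝟙
  lemma a b c d d≢0 = ≡.trans (coeff-𝟙 a b c d) (1#-homogeneous a b c d d≢0)
    where
    1#-homogeneous : Homogeneous 0 1#
    1#-homogeneous zero    zero    zero    zero    d≢0 = contradiction ≡.refl d≢0
    1#-homogeneous zero    zero    zero    (suc d) d≢0 = ≡.refl
    1#-homogeneous zero    zero    (suc c) d       d≢0 = ≡.refl
    1#-homogeneous zero    (suc b) c       d       d≢0 = ≡.refl
    1#-homogeneous (suc a) b       c       d       d≢0 = ≡.refl
weight-homogeneous ((m , c) ∷ π) =
  homogeneous-resp {f = weight ((m , c) ∷ π)} {y c ⊠ (q ⋆ m ⊠ weight π)} (weight-∷ c m π)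
    (y-⊠-homogeneous {f = q ⋆ m ⊠ weight π} c (q⋆-⊠-homogeneous m (weight-homogeneous π)))

∑ᴸ-++ : ∀ {A : Set} (f : A → PowerSeries) xs ys → ∑ᴸ f (xs ++ ys) ≐ ∑ᴸ f xs ⊞ ∑ᴸ f ys
∑ᴸ-++ f []       ys = O.sym (O.+-identityˡ _)
∑ᴸ-++ f (x ∷ xs) ys = O.trans (O.+-congˡ (∑ᴸ-++ f xs ys)) (O.sym (O.+-assoc _ _ _))

∑ᴸ-concatMap : ∀ {A A′ : Set} (f : A → PowerSeries) (g : A′ → List A) xs →
               ∑ᴸ f (concatMap g xs) ≐ ∑ᴸ (λ x → ∑ᴸ f (g x)) xs
∑ᴸ-concatMap f g []       = O.refl
∑ᴸ-concatMap f g (x ∷ xs) =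
  O.trans (∑ᴸ-++ f (g x) (concatMap g xs)) (O.+-congˡ (∑ᴸ-concatMap f g xs))

∑ᴸ-weight-∷ : ∀ c m xs → ∑ᴸ weight (map ((m , c) ∷_) xs) ≐ y c ⊠ (q ⋆ m ⊠ ∑ᴸ weight xs)
∑ᴸ-weight-∷ c m []       = O.sym (I.*-cancel-zero (y c) (q ⋆ m))
∑ᴸ-weight-∷ c m (π ∷ xs) = O.trans (O.+-cong (weight-∷ c m π) (∑ᴸ-weight-∷ c m xs))
  (O.sym (O.trans (O.*-congˡ (O.distribˡ _ _ _)) (O.distribˡ _ _ _)))

∑ᴸ-cong[] : ∀ {A : Set} {f g : A → PowerSeries} n → (∀ x → f x ≐[ n ] g x) → ∀ xs →
            ∑ᴸ f xs ≐[ n ] ∑ᴸ g xs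
∑ᴸ-cong[] n p []       a b c d lt = ≡.refl
∑ᴸ-cong[] {f = f} {g} n p (x ∷ xs) =
  ⊞-cong[] {n} {f x} {g x} {∑ᴸ f xs} {∑ᴸ g xs} (p x) (∑ᴸ-cong[] n p xs)

-- The enumeration and `𝕊` satisfy the same recursion, and one unrolling trades k for m while the
-- modulus m + k stays fixed. At k = 0 only the empty partition is listed, and `𝕊-low` applies.
enumerate-𝕊 : ∀ s k m → ∑ᴸ weight (enumerate s k m) ≐[ m ℕ.+ k ] 𝕊 s m
enumerate-𝕊 s zero    m = ≡.subst (λ n → ∑ᴸ weight ([] ∷ []) ≐[ n ] 𝕊 s m) (≡.sym (ℕ.+-identityʳ m))
  λ a b c d lt → ≡.trans
    (≐⇒≈ {∑ᴸ weight ([] ∷ [])} {𝟙} (O.trans (O.+-identityʳ _) weight-[]) a b c d)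
    (≡.sym (𝕊-low s m a b c d lt))
enumerate-𝕊 s (suc k) m = ≡.subst (λ n → ∑ᴸ weight (enumerate s (suc k) m) ≐[ n ] 𝕊 s m)
  (≡.sym (ℕ.+-suc m k))
  (≐[]-resp {f = ∑ᴸ weight (enumerate s (suc k) m)}
     {f′ = ∑ᴸ weight (enumerate (skip s) k (suc m)) ⊞ ∑ᴸ f (allowed s)}
     {g = 𝕊 s m} {g′ = 𝕊 (skip s) (suc m) ⊞ ∑ᴸ g (allowed s)}
     (O.trans (∑ᴸ-++ weight (enumerate (skip s) k (suc m)) (concatMap extend (allowed s)))
       (O.+-congˡ (O.trans (∑ᴸ-concatMap weight extend (allowed s))
         (∑ᴸ-cong (λ c → ∑ᴸ-weight-∷ c (suc m) (enumerate (after c) k (suc m))) (allowed s)))))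
     (𝕊-rec s m)
     (⊞-cong[] {suc m ℕ.+ k} {∑ᴸ weight (enumerate (skip s) k (suc m))} {𝕊 (skip s) (suc m)}
       {∑ᴸ f (allowed s)} {∑ᴸ g (allowed s)}
       (enumerate-𝕊 (skip s) k (suc m))
       (∑ᴸ-cong[] {f = f} {g} (suc m ℕ.+ k) agree (allowed s))))
  where
  extend : Color → List (List Part)
  extend c = map ((suc m , c) ∷_) (enumerate (after c) k (suc m))

  f g : Color → PowerSeries
  f c = y c ⊠ (q ⋆ suc m ⊠ ∑ᴸ weight (enumerate (after c) k (suc m)))
  g c = y c ⊠ (q ⋆ suc m ⊠ 𝕊 (after c) (suc m))

  agree : ∀ c → f c ≐[ suc m ℕ.+ k ] g c
  agree c = y-⊠-cong[] {suc m ℕ.+ k} {q ⋆ suc m ⊠ ∑ᴸ weight (enumerate (after c) k (suc m))}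
    {q ⋆ suc m ⊠ 𝕊 (after c) (suc m)} c
    (q⋆-⊠-cong[] {suc m ℕ.+ k} {∑ᴸ weight (enumerate (after c) k (suc m))} {𝕊 (after c) (suc m)}
      (suc m) (enumerate-𝕊 (after c) k (suc m)))

∑ᴸ-↭ : ∀ {A : Set} (f : A → PowerSeries) {xs ys} → xs ↭ ys → ∑ᴸ f xs ≐ ∑ᴸ f ys
∑ᴸ-↭ f Perm.refl          = O.refl
∑ᴸ-↭ f (Perm.prep x p)    = O.+-congˡ (∑ᴸ-↭ f p)
∑ᴸ-↭ f (Perm.swap x x′ p) = O.trans (O.+-congˡ (O.+-congˡ (∑ᴸ-↭ f p)))
  (O.trans (O.sym (O.+-assoc _ _ _)) (O.trans (O.+-congʳ (O.+-comm _ _)) (O.+-assoc _ _ _)))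
∑ᴸ-↭ f (Perm.trans p p′)  = O.trans (∑ᴸ-↭ f p) (∑ᴸ-↭ f p′)

ofSize? : ∀ d → Decidable (λ π → ∣ π ∣ₚ ≡ d)
ofSize? d π = ∣ π ∣ₚ ℕ.≟ d

∑ᴸ-ofSize : ∀ (f : List Part → PowerSeries) → (∀ π → Homogeneous ∣ π ∣ₚ (f π)) → ∀ xs a b c d →
            ∑ᴸ f xs a b c d ≡ ∑ᴸ f (filter (ofSize? d) xs) a b c d
∑ᴸ-ofSize f homogeneous []       a b c d = ≡.refl
∑ᴸ-ofSize f homogeneous (π ∷ xs) a b c d =
  ≡.trans (coeff-⊞ (f π) (∑ᴸ f xs) a b c d) (by-size (ofSize? d π))
  where
  by-size : Dec (∣ π ∣ₚ ≡ d) → f π a b c d ℤ.+ ∑ᴸ f xs a b c d ≡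
            ∑ᴸ f (filter (ofSize? d) (π ∷ xs)) a b c d
  by-size (yes ≡d) = ≡.trans
    (≡.cong (ℤ._+_ (f π a b c d)) (∑ᴸ-ofSize f homogeneous xs a b c d)) (≡.trans
    (≡.sym (coeff-⊞ (f π) (∑ᴸ f (filter (ofSize? d) xs)) a b c d))
    (≡.cong (λ ys → ∑ᴸ f ys a b c d) (≡.sym (filter-accept (ofSize? d) {x = π} {xs} ≡d))))
  by-size (no ≢d) = ≡.trans
    (≡.cong₂ ℤ._+_ (homogeneous π a b c d (λ eq → ≢d (≡.sym eq))) (∑ᴸ-ofSize f homogeneous xs a b c d))
    (≡.trans (ℤ.+-identityˡ _)
    (≡.cong (λ ys → ∑ᴸ f ys a b c d) (≡.sym (filter-reject (ofSize? d) {x = π} {xs} ≢d))))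

foldr-∑ᴸ : ∀ {A : Set} (f : A → PowerSeries) xs → foldr _+_ 0# (map f xs) ≡ ∑ᴸ f xs
foldr-∑ᴸ f []       = 0≡𝟘
foldr-∑ᴸ f (x ∷ xs) = ≡.trans (+≡⊞ (f x) (foldr _+_ 0# (map f xs)))
  (≡.cong (f x ⊞_) (foldr-∑ᴸ f xs))

∑ᴸ-weight-vanish : ∀ {n d} a b c → d ≢ n → ∀ {xs} → All (λ π → ∣ π ∣ₚ ≡ n) xs →
                   ∑ᴸ weight xs a b c d ≡ 0ℤ
∑ᴸ-weight-vanish {n} {d} a b c d≢n []                = coeff-𝟘 a b c d
∑ᴸ-weight-vanish {n} {d} a b c d≢n {π ∷ xs} (eq ∷ p) =
  ≡.trans (coeff-⊞ (weight π) (∑ᴸ weight xs) a b c d) (≡.cong₂ ℤ._+_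
    (weight-homogeneous π a b c d (λ eq′ → d≢n (≡.trans eq′ eq))) (∑ᴸ-weight-vanish a b c d≢n p))

-- Identification of the generating functions

module _ (s : State) {P : Pred (List Part) 0ℓ} (P? : Decidable P)
         (P⇒ : ∀ {π} → P π → Λ π × All (_∉ excluded s 0) π)
         (⇒P : ∀ {π} → Λ π → All (_∉ excluded s 0) π → P π) where

  -- Two lists without repetitions and with the same members are permutations of each other, so only
  -- membership is compared. A part never exceeds the size d of its partition, hence depth d + 1
  -- loses nothing.
  filter-partitions-↭ : ∀ d → filter P? (partitions d) ↭ filter (ofSize? d) (enumerate s (suc d) 0)
  filter-partitions-↭ d = ∼bag⇒↭ (unique∧set⇒bag
    (Unique.filter⁺ P? (partitions-unique d))
    (Unique.filter⁺ (ofSize? d) (enumerate-unique s (suc d) 0))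
    (mk⇔ to from))
    where
    to : ∀ {π} → π ∈ filter P? (partitions d) → π ∈ filter (ofSize? d) (enumerate s (suc d) 0)
    to {π} i with ∈-filter⁻ P? {xs = partitions d} i
    ... | π∈ , Pπ with partitions-sound {d} π∈ | P⇒ Pπ
    ...   | (pos , _) , eq | Λπ , avoids = ∈-filter⁺ (ofSize? d)
      (enumerate-complete s (suc d) 0 (admissible Λπ pos avoids)
        (All.map (λ le → ℕ.m≤n⇒m≤1+n (ℕ.≤-trans le (ℕ.≤-reflexive eq))) parts≤∣ π ∣ₚ))
      eq

    from : ∀ {π} → π ∈ filter (ofSize? d) (enumerate s (suc d) 0) → π ∈ filter P? (partitions d)
    from i with ∈-filter⁻ (ofSize? d) {xs = enumerate s (suc d) 0} i
    ... | π∈ , eq with enumerate-sound s (suc d) 0 π∈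
    ...   | admissible Λπ _ avoids =
      ∈-filter⁺ P? (partitions-complete (proj₁ Λπ) eq) (⇒P Λπ avoids)

  level : ℕ → PowerSeries
  level n = foldr _+_ 0# (map weight (filter P? (partitions n)))

  level-∑ᴸ : ∀ n a b c d → level n a b c d ≡ ∑ᴸ weight (filter P? (partitions n)) a b c d
  level-∑ᴸ n a b c d = ≡.cong (λ f → f a b c d) (foldr-∑ᴸ weight (filter P? (partitions n)))

  level-vanish : ∀ n a b c d → d ≢ n → level n a b c d ≡ 0ℤ
  level-vanish n a b c d d≢n = ≡.trans (level-∑ᴸ n a b c d) (∑ᴸ-weight-vanish a b c d≢n
    (All.tabulate λ i → proj₂ (partitions-sound {n} (proj₁ (∈-filter⁻ P? {xs = partitions n} i)))))

  GF-∑∞ : ∀ a b c d → GF P? a b c d ≡ ∑∞ level a b c d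
  GF-∑∞ a b c d = ≡.refl

  GF-𝕊 : ∀ a b c d → GF P? a b c d ≡ 𝕊 s 0 a b c d
  GF-𝕊 a b c d = begin
    GF P? a b c d
      ≡⟨ GF-∑∞ a b c d ⟩
    ∑∞ level a b c d
      ≡⟨ coeff-∑∞ level a b c d ⟩
    sumTo (suc (a ℕ.+ b ℕ.+ c ℕ.+ d)) (λ n → level n a b c d)
      ≡⟨ sumTo-single {h = λ n → level n a b c d} (s≤s (ℕ.m≤n+m d (a ℕ.+ b ℕ.+ c)))
           (λ n n≢d → level-vanish n a b c d (≡.≢-sym n≢d)) ⟩
    level d a b c d
      ≡⟨ level-∑ᴸ d a b c d ⟩
    ∑ᴸ weight (filter P? (partitions d)) a b c d
      ≡⟨ ≐⇒≈ {∑ᴸ weight (filter P? (partitions d))}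
           {∑ᴸ weight (filter (ofSize? d) (enumerate s (suc d) 0))}
           (∑ᴸ-↭ weight (filter-partitions-↭ d)) a b c d ⟩
    ∑ᴸ weight (filter (ofSize? d) (enumerate s (suc d) 0)) a b c d
      -- The full enumeration also lists partitions of other sizes, but their weights have no term
      -- in qᵈ.
      ≡⟨ ∑ᴸ-ofSize weight weight-homogeneous (enumerate s (suc d) 0) a b c d ⟨
    ∑ᴸ weight (enumerate s (suc d) 0) a b c d
      -- Depth d + 1 gives agreement modulo the power d + 1 of q, the least that covers the
      -- coefficient of qᵈ.
      ≡⟨ enumerate-𝕊 s (suc d) 0 a b c d ℕ.≤-refl ⟩
    𝕊 s 0 a b c d ∎
    where open ≡.≡-Reasoning

-- The right-hand sides of the theorem

𝕊-rows : ∀ s → 𝕊 s 0 ≐ rows (h s)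
𝕊-rows s = rows-cong λ a b c → O.*-identityˡ (h s a b c)

f*q^n≡f⊠q⋆n : ∀ (f : PowerSeries) n → f * q ^ n ≡ f ⊠ q ⋆ n
f*q^n≡f⊠q⋆n f n = *≡⊠-cong f (q ^ n) ≡.refl (^≡⋆ q n)

q⋆-constant : ∀ n → IsConstant (q ⋆ n)
q⋆-constant = ⋆-constant {q} q-constant

T-afterRG : T (y₁ * q ^ 3) (y₂ * q) (y₃ * q ^ 2) ≐ rows (h afterRG)
T-afterRG = O.trans
  (T-rows (f*q^n≡f⊠q⋆n y₁ 3) (*≡⊠ y₂ q) (f*q^n≡f⊠q⋆n y₃ 2) (q⋆-constant 3) q-constant (q⋆-constant 2))
  (rows-cong λ a b c → O.trans
    (O.*-congʳ (O.*-cong (O.*-congʳ (I.^3^n≈^n*^n*^n q a)) (I.^2^n≈^n*^n q c)))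
    (I.form-c (q ⋆ a) (q ⋆ b) (q ⋆ c) (t a b c)))

T-afterB : T (y₁ * q ^ 2) (y₂ * q ^ 2) (y₃ * q) ≐ rows (h afterB)
T-afterB = O.trans
  (T-rows (f*q^n≡f⊠q⋆n y₁ 2) (f*q^n≡f⊠q⋆n y₂ 2) (*≡⊠ y₃ q) (q⋆-constant 2) (q⋆-constant 2) q-constant)
  (rows-cong λ a b c → O.trans
    (O.*-congʳ (O.*-congʳ (O.*-cong (I.^2^n≈^n*^n q a) (I.^2^n≈^n*^n q b))))
    (I.form-d (q ⋆ a) (q ⋆ b) (q ⋆ c) (t a b c)))

q-y-rows : ∀ col r → y col ⊠ q ⊠ rows r ≐ rows (previous 𝟘 col (λ a b c → q ⊠ r a b c))
q-y-rows col r = O.trans (O.*-assoc _ _ _) (O.trans (O.*-congˡ (q-⊠-rows r))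
  (y-⊠-rows col (λ a b c → q ⊠ r a b c)))

T-noR : T (y₁ * q ^ 2) (y₂ * q ^ 2) (y₃ * q) ⊞ y₂ ⊠ q ⊠ T (y₁ * q ^ 4) (y₂ * q ^ 2) (y₃ * q ^ 3)
        ≐ rows (h noR)
T-noR = O.trans (O.+-cong T-afterB (O.trans (O.*-congˡ
    (T-rows (f*q^n≡f⊠q⋆n y₁ 4) (f*q^n≡f⊠q⋆n y₂ 2) (f*q^n≡f⊠q⋆n y₃ 3)
      (q⋆-constant 4) (q⋆-constant 2) (q⋆-constant 3)))
    (O.trans (q-y-rows G r) (rows-cong pointwise))))
  (O.sym (rows-⊞ (h afterB) (λ a b c → q ⋆ a ⊠ q ⋆ a ⊠ q ⋆ a ⊠ q ⋆ b ⊠ q ⋆ c ⊠ q ⋆ c ⊠ P₂ a b c)))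
  where
  r : ℕ → ℕ → ℕ → PowerSeries
  r a b c = ((q ⋆ 4) ⋆ a ⊠ (q ⋆ 2) ⋆ b ⊠ (q ⋆ 3) ⋆ c) ⊠ t a b c

  pointwise : ∀ a b c → previous 𝟘 G (λ a b c → q ⊠ r a b c) a b c ≐
              q ⋆ a ⊠ q ⋆ a ⊠ q ⋆ a ⊠ q ⋆ b ⊠ q ⋆ c ⊠ q ⋆ c ⊠ P₂ a b c
  pointwise a zero    c = O.sym (O.zeroʳ _)
  pointwise a (suc b) c = O.trans
    (O.*-congˡ (O.*-congʳ (O.*-cong (O.*-cong (I.^4^n≈^n*^n*^n*^n q a) (I.^2^n≈^n*^n q b))
      (I.^3^n≈^n*^n*^n q c))))
    (I.form-b q (q ⋆ a) (q ⋆ b) (q ⋆ c) (t a b c))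

-- Multiplication by y₃q moves q A³B³C² t from index c to c + 1. There C has become qC and `P₃`
-- equals the ABC t of the old index, so the moved term is the second summand A²B²C P₃ of `hᵃ`.
T-free : T (y₁ * q) (y₂ * q) (y₃ * q ^ 2) ⊞ y₃ ⊠ q ⊠ T (y₁ * q ^ 3) (y₂ * q ^ 3) (y₃ * q ^ 2)
         ≐ rows (h free)
T-free = O.trans (O.+-cong
    (O.trans (T-rows (*≡⊠ y₁ q) (*≡⊠ y₂ q) (f*q^n≡f⊠q⋆n y₃ 2) q-constant q-constant (q⋆-constant 2))
      (rows-cong λ a b c → O.trans (O.*-congʳ (O.*-congˡ (I.^2^n≈^n*^n q c)))
        (I.form-a (q ⋆ a) (q ⋆ b) (q ⋆ c) (t a b c))))
    (O.trans (O.*-congˡ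
      (T-rows (f*q^n≡f⊠q⋆n y₁ 3) (f*q^n≡f⊠q⋆n y₂ 3) (f*q^n≡f⊠q⋆n y₃ 2)
        (q⋆-constant 3) (q⋆-constant 3) (q⋆-constant 2)))
      (O.trans (q-y-rows B r) (rows-cong pointwise))))
  (O.sym (rows-⊞ (λ a b c → q ⋆ a ⊠ q ⋆ b ⊠ q ⋆ c ⊠ q ⋆ c ⊠ t a b c)
                 (λ a b c → q ⋆ a ⊠ q ⋆ a ⊠ q ⋆ b ⊠ q ⋆ b ⊠ q ⋆ c ⊠ P₃ a b c)))
  where
  r : ℕ → ℕ → ℕ → PowerSeries
  r a b c = ((q ⋆ 3) ⋆ a ⊠ (q ⋆ 3) ⋆ b ⊠ (q ⋆ 2) ⋆ c) ⊠ t a b c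

  pointwise : ∀ a b c → previous 𝟘 B (λ a b c → q ⊠ r a b c) a b c ≐
              q ⋆ a ⊠ q ⋆ a ⊠ q ⋆ b ⊠ q ⋆ b ⊠ q ⋆ c ⊠ P₃ a b c
  pointwise a b zero    = O.sym (O.zeroʳ _)
  pointwise a b (suc c) = O.trans
    (O.*-congˡ (O.*-congʳ (O.*-cong (O.*-cong (I.^3^n≈^n*^n*^n q a) (I.^3^n≈^n*^n*^n q b))
      (I.^2^n≈^n*^n q c))))
    (I.form-a′ q (q ⋆ a) (q ⋆ b) (q ⋆ c) (t a b c))

+-*≡⊞-⊠ : ∀ f y g → f + y * q * g ≡ f ⊞ y ⊠ q ⊠ g
+-*≡⊞-⊠ f y g = ≡.trans (+≡⊞ f (y * q * g)) (≡.cong (f ⊞_) (*≡⊠-cong (y * q) g (*≡⊠ y q) ≡.refl))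

module _ {f : PowerSeries} {s : State} (f≡𝕊 : ∀ a b c d → f a b c d ≡ 𝕊 s 0 a b c d) where

  f≐rows : f ≐ rows (h s)
  f≐rows = O.trans (≈⇒≐ {f} {𝕊 s 0} f≡𝕊) (𝕊-rows s)

  conclude : ∀ {g} → g ≐ rows (h s) → f ≐ g
  conclude p = O.trans f≐rows (O.sym p)

  conclude-+ : ∀ {l y m g} → l ⊞ y ⊠ q ⊠ m ≐ rows (h s) → g ≡ l + y * q * m → f ≐ g
  conclude-+ {l} {y} {m} p g≡ = ≡.subst (f ≐_) (≡.sym (≡.trans g≡ (+-*≡⊞-⊠ l y m))) (conclude p)

identity-free : GF Λ? ≐ T (y₁ * q) (y₂ * q) (y₃ * q ^ 2)
  + y₃ * q * T (y₁ * q ^ 3) (y₂ * q ^ 3) (y₃ * q ^ 2)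
identity-free = conclude-+ {GF Λ?} {free}
  (GF-𝕊 free Λ? (λ Λπ → Λπ , All.tabulate λ _ ()) (λ Λπ _ → Λπ)) T-free ≡.refl

-- The excluded set of the statement is `excluded noR 0` by computation, so the two descriptions of
-- the partitions coincide without any conversion. The same happens in the two identities below.
identity-noR : GF Λ[ (1 , R) ∷ [] ]? ≐ T (y₁ * q ^ 2) (y₂ * q ^ 2) (y₃ * q)
  + y₂ * q * T (y₁ * q ^ 4) (y₂ * q ^ 2) (y₃ * q ^ 3)
identity-noR = conclude-+ {GF Λ[ (1 , R) ∷ [] ]?} {noR}
  (GF-𝕊 noR Λ[ (1 , R) ∷ [] ]? (λ p → p) _,_) T-noR ≡.refl

identity-afterRG : GF Λ[ (1 , R) ∷ (2 , R) ∷ (1 , B) ∷ [] ]? ≐ T (y₁ * q ^ 3) (y₂ * q) (y₃ * q ^ 2)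
identity-afterRG = conclude {GF Λ[ (1 , R) ∷ (2 , R) ∷ (1 , B) ∷ [] ]?} {afterRG}
  (GF-𝕊 afterRG Λ[ (1 , R) ∷ (2 , R) ∷ (1 , B) ∷ [] ]? (λ p → p) _,_) T-afterRG

identity-afterB : GF Λ[ (1 , R) ∷ (1 , G) ∷ [] ]? ≐ T (y₁ * q ^ 2) (y₂ * q ^ 2) (y₃ * q)
identity-afterB = conclude {GF Λ[ (1 , R) ∷ (1 , G) ∷ [] ]?} {afterB}
  (GF-𝕊 afterB Λ[ (1 , R) ∷ (1 , G) ∷ [] ]? (λ p → p) _,_) T-afterB

theorem1p1 : (GF Λ? ≈ T (y₁ * q) (y₂ * q) (y₃ * q ^ 2)
    + y₃ * q * T (y₁ * q ^ 3) (y₂ * q ^ 3) (y₃ * q ^ 2))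
    × (GF Λ[ (1 , R) ∷ [] ]? ≈ T (y₁ * q ^ 2) (y₂ * q ^ 2) (y₃ * q)
    + y₂ * q * T (y₁ * q ^ 4) (y₂ * q ^ 2) (y₃ * q ^ 3))
    × (GF Λ[ (1 , R) ∷ (2 , R) ∷ (1 , B) ∷ [] ]? ≈ T (y₁ * q ^ 3) (y₂ * q) (y₃ * q ^ 2))
    × (GF Λ[ (1 , R) ∷ (1 , G) ∷ [] ]? ≈ T (y₁ * q ^ 2) (y₂ * q ^ 2) (y₃ * q))
theorem1p1 =
    (λ a b c d → ≐⇒≈ identity-free a b c d)
  , (λ a b c d → ≐⇒≈ identity-noR a b c d)
  , (λ a b c d → ≐⇒≈ identity-afterRG a b c d)
  , (λ a b c d → ≐⇒≈ identity-afterB a b c d)
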